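{- For any unimodal range map $\delta$, if $\delta$ is not $1$-dominated, then the space $\mathcal{R}_\delta$ of the nontrivial relations of $\mathbf{Cl}_\delta$ is not finitely generated.
   Context: $\mathbb{N}=\{0,1,2,\dots\}$ and $\mathbb{K}$ is a field of characteristic zero. A range map is a map $\delta:\mathbb{N}\setminus\{0\}\to\mathbb{N}$. It is unimodal if there are no $1\le i_1<i_2<i_3$ with $\delta(i_1)>\delta(i_2)<\delta(i_3)$. It is $1$-dominated if there is a $k\ge1$ such that $\delta(1)\ge\delta(k')$ for all $k'\ge k$. For a word $w$ on $\mathbb{N}$, $\ell(w)$ is its length, $w(i)$ its $i$-th letter, $\epsilon$ is the empty word. A $\delta$-cliff is a word $w$ on $\mathbb{N}$ with $0\le w(i)\le\delta(i)$ for all $i$; its size is $|w|:=\ell(w)+1$; $\mathsf{Cl}_\delta$ is the graded set of all $\delta$-cliffs. For words $u,v$ and $1\le i\le|u|$, $u\,\square_i\,v:=u(1)\cdots u(i-1)\;v\;u(i)\cdots u(\ell(u))$. For $\delta$ unimodal, $\mathbf{Cl}_\delta$ is the nonsymmetric operad over $\mathbb{K}$ with basis $\{\mathsf{E}_w:w\in\mathsf{Cl}_\delta\}$ ($\mathsf{E}_w$ of arity $|w|$), partial compositions $\mathsf{E}_u\circ_i\mathsf{E}_v=\mathsf{E}_{u\,\square_i\,v}$ if $u\,\square_i\,v\in\mathsf{Cl}_\delta$ and $\mathsf{E}_u\circ_i\mathsf{E}_v=0$ otherwise, and unit $\mathsf{E}_\epsilon$. A nonempty $\delta$-cliff $w$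 is $\delta$-prime if $w=u\,\square_i\,v$ with $u,v\in\mathsf{Cl}_\delta$ and $1\le i\le|u|$ implies $(u,v)\in\{(w,\epsilon),(\epsilon,w)\}$. Let $\mathfrak{G}_\delta:=\{\mathsf{E}_w:w \text{ a } \delta\text{ -prime } \delta\text{ -cliff}\}$, which is a minimal generating set of $\mathbf{Cl}_\delta$. The nontrivial relations of $\mathbf{Cl}_\delta$ are those of its presentation with generating set $\mathfrak{G}_\delta$, i.e. the elements of the kernel of the canonical surjective operad morphism from the free nonsymmetric operad on $\mathfrak{G}_\delta$ to $\mathbf{Cl}_\delta$; "not finitely generated" means that this kernel is not generated, as an operad ideal of the free operad, by any finite set of elements. -}

module Defs where

open import Level using (Level; _⊔_) renaming (suc to lsuc)
open import Algebra.Apartness.Bundles using (HeytingField; HeytingCommutativeRing)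
open import Algebra.Bundles using (CommutativeRing)
open import Algebra.Module.Bundles using (LeftModule)
open import Algebra.Module.Morphism.Structures using (IsLeftModuleHomomorphism)
import Algebra.Properties.CommutativeSemigroup as CommutativeSemigroupProperties
import Algebra.Properties.Ring as RingProperties
import Algebra.Properties.Semiring.Mult as SemiringMult
open import Data.Bool.Base using (true; false; if_then_else_)
open import Data.Fin.Base using (Fin; zero; suc; toℕ)
open import Data.Fin.Properties using (all?; toℕ<n)
open import Data.List.Base using (List; []; _∷_; _++_; map; concatMap; length; lookup; take; drop)
open import Data.List.Membership.Propositional using (_∈_)
open import Data.List.Properties
  using (length-++; take++drop≡id; ++-assoc; ++-identityʳ; ≡-dec; length-take)
open import Data.Nat.Base
  using (ℕ; zero; suc; _+_; _∸_; _≤_; _<_; _>_; z≤n; s≤s; NonZero)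
import Data.Nat.Properties as ℕₚ
open import Data.Product.Base using (Σ; ∃-syntax; _×_; _,_; proj₁; proj₂)
open import Data.Sum.Base using (_⊎_)
open import Function.Base using (_∘_)
open import Function.Bundles using (_⇔_)
open import Relation.Binary.Definitions using (DecidableEquality)
open import Relation.Binary.PropositionalEquality
  using (_≡_; _≢_; refl; sym; trans; cong; cong₂; subst; module ≡-Reasoning)
import Relation.Binary.Reasoning.Setoid as SetoidReasoning
open import Relation.Nullary.Decidable.Core using (Dec; yes; no; does; recompute; map′)
open import Relation.Nullary.Negation.Core using (¬_; contradiction)

baseRing : ∀ {c ℓ₁ ℓ₂} → HeytingField c ℓ₁ ℓ₂ → CommutativeRing c ℓ₁
baseRing K = HeytingCommutativeRing.commutativeRing (HeytingField.heytingCommutativeRing K)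

CharacteristicZero : ∀ {c ℓ₁ ℓ₂} → HeytingField c ℓ₁ ℓ₂ → Set ℓ₁
CharacteristicZero K = ∀ n → ¬ (suc n · 1# ≈ 0#)
  where
  open CommutativeRing (baseRing K)
  open SemiringMult semiring using () renaming (_×_ to _·_)

-- `space n` is the component of arity n.  Inputs are numbered from 0, and
-- x ∘[ i ] y by p is the partial composition x ∘ᵢ₊₁ y of the literature.
-- Its result has arity m + n − 1; this is carried by the irrelevant
-- equation p, so that associativity can be stated without transports.
record NSOperad {c ℓ} (K : CommutativeRing c ℓ) (a ℓa : Level) :
                Set (c ⊔ ℓ ⊔ lsuc (a ⊔ ℓa)) where
  open CommutativeRing K using (ring) renaming (Carrier to Scalar)

  infix 6 _∘[_]_by_

  field
    space : ℕ → LeftModule ring a ℓa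

  open module Space {n} = LeftModule (space n) public

  Carrier : ℕ → Set a
  Carrier n = Carrierᴹ {n}

  field
    _∘[_]_by_ : ∀ {m n r} → Carrier m → Fin m → Carrier n → .(suc r ≡ m + n) → Carrier r
    unit      : Carrier 1

    ∘-cong      : ∀ {m n r} {x x′ : Carrier m} {i} {y y′ : Carrier n} .{p : suc r ≡ m + n} →
                  x ≈ᴹ x′ → y ≈ᴹ y′ → (x ∘[ i ] y by p) ≈ᴹ (x′ ∘[ i ] y′ by p)
    ∘-+ˡ        : ∀ {m n r} {x x′ : Carrier m} {i} {y : Carrier n} .{p : suc r ≡ m + n} →
                  ((x +ᴹ x′) ∘[ i ] y by p) ≈ᴹ (x ∘[ i ] y by p) +ᴹ (x′ ∘[ i ] y by p)
    ∘-+ʳ        : ∀ {m n r} {x : Carrier m} {i} {y y′ : Carrier n} .{p : suc r ≡ m + n} →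
                  (x ∘[ i ] (y +ᴹ y′) by p) ≈ᴹ (x ∘[ i ] y by p) +ᴹ (x ∘[ i ] y′ by p)
    ∘-*ˡ        : ∀ {m n r} {k : Scalar} {x : Carrier m} {i} {y : Carrier n}
                  .{p : suc r ≡ m + n} →
                  ((k *ₗ x) ∘[ i ] y by p) ≈ᴹ k *ₗ (x ∘[ i ] y by p)
    ∘-*ʳ        : ∀ {m n r} {k : Scalar} {x : Carrier m} {i} {y : Carrier n}
                  .{p : suc r ≡ m + n} →
                  (x ∘[ i ] (k *ₗ y) by p) ≈ᴹ k *ₗ (x ∘[ i ] y by p)
    ∘-identityˡ : ∀ {n} {x : Carrier n} → (unit ∘[ zero ] x by refl) ≈ᴹ x
    ∘-identityʳ : ∀ {n} {x : Carrier n} {i} .{p : suc n ≡ n + 1} →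
                  (x ∘[ i ] unit by p) ≈ᴹ x
    ∘-assoc     : ∀ {m n o r s t} {x : Carrier m} {y : Carrier n} {z : Carrier o}
                  {i : Fin m} {j : Fin n} {k : Fin r}
                  .{p : suc r ≡ m + n} .{q : suc t ≡ r + o}
                  .{p′ : suc s ≡ n + o} .{q′ : suc t ≡ m + s} →
                  toℕ k ≡ toℕ i + toℕ j →
                  ((x ∘[ i ] y by p) ∘[ k ] z by q) ≈ᴹ (x ∘[ i ] (y ∘[ j ] z by p′) by q′)
    ∘-parallel  : ∀ {m n o r s t} {x : Carrier m} {y : Carrier n} {z : Carrier o}
                  {i j : Fin m} {k : Fin r} {l : Fin s}
                  .{p : suc r ≡ m + n} .{q : suc t ≡ r + o}
                  .{p′ : suc s ≡ m + o} .{q′ : suc t ≡ s + n} →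
                  toℕ i < toℕ j → suc (toℕ k) ≡ toℕ j + n → toℕ l ≡ toℕ i →
                  ((x ∘[ i ] y by p) ∘[ k ] z by q) ≈ᴹ ((x ∘[ j ] z by p′) ∘[ l ] y by q′)

module _ {c ℓ} {K : CommutativeRing c ℓ} where

  module _ {a ℓa b ℓb} (P : NSOperad K a ℓa) (Q : NSOperad K b ℓb) where
    private
      module P = NSOperad P
      module Q = NSOperad Q

    record Morphism : Set (c ⊔ ℓ ⊔ a ⊔ ℓa ⊔ b ⊔ ℓb) where
      field
        ⟦_⟧                    : ∀ {n} → P.Carrier n → Q.Carrier n
        isLeftModuleHomomorphism : ∀ n → IsLeftModuleHomomorphism
          (LeftModule.rawLeftModule (P.space n)) (LeftModule.rawLeftModule (Q.space n)) (⟦_⟧ {n})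
        ∘-homo                 : ∀ {m n r} {x : P.Carrier m} {i} {y : P.Carrier n}
                                 .{p : suc r ≡ m + n} →
                                 ⟦ x P.∘[ i ] y by p ⟧ Q.≈ᴹ (⟦ x ⟧ Q.∘[ i ] ⟦ y ⟧ by p)
        unit-homo              : ⟦ P.unit ⟧ Q.≈ᴹ Q.unit

  Kernel : ∀ {a ℓa b ℓb} {P : NSOperad K a ℓa} {Q : NSOperad K b ℓb} → Morphism P Q →
           ∀ {n} → NSOperad.Carrier P n → Set ℓb
  Kernel {Q = Q} φ {n} x = Morphism.⟦ φ ⟧ x ≈ᴹ 0ᴹ
    where open LeftModule (NSOperad.space Q n)

  module _ {a ℓa} (P : NSOperad K a ℓa) where
    open NSOperad P
    open CommutativeRing K using () renaming (Carrier to Scalar)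

    -- The smallest operad ideal containing every element of S.
    data IdealGeneratedBy (S : List (Σ ℕ Carrier)) :
                          ∀ {n} → Carrier n → Set (c ⊔ a ⊔ ℓa) where
      generator : ∀ {n x} → (n , x) ∈ S → IdealGeneratedBy S x
      resp-≈    : ∀ {n} {x y : Carrier n} → x ≈ᴹ y →
                  IdealGeneratedBy S x → IdealGeneratedBy S y
      zero-mem  : ∀ {n} → IdealGeneratedBy S (0ᴹ {n})
      +-mem     : ∀ {n} {x y : Carrier n} →
                  IdealGeneratedBy S x → IdealGeneratedBy S y → IdealGeneratedBy S (x +ᴹ y)
      *-mem     : ∀ {n} (k : Scalar) {x : Carrier n} →
                  IdealGeneratedBy S x → IdealGeneratedBy S (k *ₗ x)
      ∘-memˡ    : ∀ {m n r} {x : Carrier m} (i : Fin m) (y : Carrier n) .(p : suc r ≡ m + n) →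
                  IdealGeneratedBy S x → IdealGeneratedBy S (x ∘[ i ] y by p)
      ∘-memʳ    : ∀ {m n r} (x : Carrier m) (i : Fin m) {y : Carrier n} .(p : suc r ≡ m + n) →
                  IdealGeneratedBy S y → IdealGeneratedBy S (x ∘[ i ] y by p)

    FinitelyGeneratedIdeal : ∀ {i} → (∀ {n} → Carrier n → Set i) → Set (c ⊔ a ⊔ ℓa ⊔ i)
    FinitelyGeneratedIdeal I =
      ∃[ S ] (∀ {n} (x : Carrier n) → I x ⇔ IdealGeneratedBy S x)

-- The free operad on the graded set G is built as the term algebra of the
-- theory of operads, modulo that theory; `lift` is its universal property.
module FreeOperad {c ℓ} (K : CommutativeRing c ℓ) (G : ℕ → Set) where
  private module K = CommutativeRing K

  infixl 6 _⊕_
  infixr 7 _⊛_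
  infix  8 _∘[_]_by_
  infix  4 _≋_

  data Term : ℕ → Set c where
    gen       : ∀ {n} → G n → Term n
    unit      : Term 1
    _∘[_]_by_ : ∀ {m n r} → Term m → Fin m → Term n → .(suc r ≡ m + n) → Term r
    𝟘         : ∀ {n} → Term n
    _⊕_       : ∀ {n} → Term n → Term n → Term n
    _⊛_       : ∀ {n} → K.Carrier → Term n → Term n

  data _≋_ : ∀ {n} → Term n → Term n → Set (c ⊔ ℓ) where
    ≋-refl      : ∀ {n} {x : Term n} → x ≋ x
    ≋-sym       : ∀ {n} {x y : Term n} → x ≋ y → y ≋ x
    ≋-trans     : ∀ {n} {x y z : Term n} → x ≋ y → y ≋ z → x ≋ z

    ⊕-cong      : ∀ {n} {x x′ y y′ : Term n} → x ≋ x′ → y ≋ y′ → x ⊕ y ≋ x′ ⊕ y′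
    ⊛-cong      : ∀ {n} {k k′} {x x′ : Term n} → k K.≈ k′ → x ≋ x′ → k ⊛ x ≋ k′ ⊛ x′
    ⊕-assoc     : ∀ {n} {x y z : Term n} → (x ⊕ y) ⊕ z ≋ x ⊕ (y ⊕ z)
    ⊕-comm      : ∀ {n} {x y : Term n} → x ⊕ y ≋ y ⊕ x
    ⊕-identityˡ : ∀ {n} {x : Term n} → 𝟘 ⊕ x ≋ x
    ⊛-zeroˡ     : ∀ {n} {x : Term n} → K.0# ⊛ x ≋ 𝟘
    ⊛-identityˡ : ∀ {n} {x : Term n} → K.1# ⊛ x ≋ x
    ⊛-assoc     : ∀ {n} {k l} {x : Term n} → (k K.* l) ⊛ x ≋ k ⊛ l ⊛ x
    ⊛-distribʳ  : ∀ {n} {k l} {x : Term n} → (k K.+ l) ⊛ x ≋ k ⊛ x ⊕ l ⊛ x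
    ⊛-distribˡ  : ∀ {n} {k} {x y : Term n} → k ⊛ (x ⊕ y) ≋ k ⊛ x ⊕ k ⊛ y

    ∘-cong      : ∀ {m n r} {x x′ : Term m} {i} {y y′ : Term n} .{p : suc r ≡ m + n} →
                  x ≋ x′ → y ≋ y′ → x ∘[ i ] y by p ≋ x′ ∘[ i ] y′ by p
    ∘-⊕ˡ        : ∀ {m n r} {x x′ : Term m} {i} {y : Term n} .{p : suc r ≡ m + n} →
                  (x ⊕ x′) ∘[ i ] y by p ≋ x ∘[ i ] y by p ⊕ x′ ∘[ i ] y by p
    ∘-⊕ʳ        : ∀ {m n r} {x : Term m} {i} {y y′ : Term n} .{p : suc r ≡ m + n} →
                  x ∘[ i ] (y ⊕ y′) by p ≋ x ∘[ i ] y by p ⊕ x ∘[ i ] y′ by p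
    ∘-⊛ˡ        : ∀ {m n r} {k} {x : Term m} {i} {y : Term n} .{p : suc r ≡ m + n} →
                  (k ⊛ x) ∘[ i ] y by p ≋ k ⊛ (x ∘[ i ] y by p)
    ∘-⊛ʳ        : ∀ {m n r} {k} {x : Term m} {i} {y : Term n} .{p : suc r ≡ m + n} →
                  x ∘[ i ] (k ⊛ y) by p ≋ k ⊛ (x ∘[ i ] y by p)
    ∘-identityˡ : ∀ {n} {x : Term n} → unit ∘[ zero ] x by refl ≋ x
    ∘-identityʳ : ∀ {n} {x : Term n} {i} .{p : suc n ≡ n + 1} → x ∘[ i ] unit by p ≋ x
    ∘-assoc     : ∀ {m n o r s t} {x : Term m} {y : Term n} {z : Term o}
                  {i : Fin m} {j : Fin n} {k : Fin r}
                  .{p : suc r ≡ m + n} .{q : suc t ≡ r + o}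
                  .{p′ : suc s ≡ n + o} .{q′ : suc t ≡ m + s} →
                  toℕ k ≡ toℕ i + toℕ j →
                  (x ∘[ i ] y by p) ∘[ k ] z by q ≋ x ∘[ i ] (y ∘[ j ] z by p′) by q′
    ∘-parallel  : ∀ {m n o r s t} {x : Term m} {y : Term n} {z : Term o}
                  {i j : Fin m} {k : Fin r} {l : Fin s}
                  .{p : suc r ≡ m + n} .{q : suc t ≡ r + o}
                  .{p′ : suc s ≡ m + o} .{q′ : suc t ≡ s + n} →
                  toℕ i < toℕ j → suc (toℕ k) ≡ toℕ j + n → toℕ l ≡ toℕ i →
                  (x ∘[ i ] y by p) ∘[ k ] z by q ≋ (x ∘[ j ] z by p′) ∘[ l ] y by q′

  private
    ⊛-zeroʳ : ∀ {n} {k} → k ⊛ 𝟘 {n} ≋ 𝟘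
    ⊛-zeroʳ {k = k} =
      ≋-trans (⊛-cong K.refl (≋-sym ⊛-zeroˡ))
      (≋-trans (≋-sym ⊛-assoc)
      (≋-trans (⊛-cong (K.zeroʳ k) ≋-refl) (⊛-zeroˡ {x = 𝟘})))

    ⊕-inverseˡ : ∀ {n} {x : Term n} → (K.- K.1#) ⊛ x ⊕ x ≋ 𝟘
    ⊕-inverseˡ =
      ≋-trans (⊕-cong ≋-refl (≋-sym ⊛-identityˡ))
      (≋-trans (≋-sym ⊛-distribʳ)
      (≋-trans (⊛-cong (K.-‿inverseˡ K.1#) ≋-refl) ⊛-zeroˡ))

  termModule : ℕ → LeftModule K.ring c (c ⊔ ℓ)
  termModule n = record
    { Carrierᴹ = Term n
    ; _≈ᴹ_ = _≋_
    ; _+ᴹ_ = _⊕_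
    ; _*ₗ_ = _⊛_
    ; 0ᴹ = 𝟘
    ; -ᴹ_ = (K.- K.1#) ⊛_
    ; isLeftModule = record
      { isLeftSemimodule = record
        { +ᴹ-isCommutativeMonoid = record
          { isMonoid = record
            { isSemigroup = record
              { isMagma = record
                { isEquivalence = record { refl = ≋-refl ; sym = ≋-sym ; trans = ≋-trans }
                ; ∙-cong = ⊕-cong
                }
              ; assoc = λ _ _ _ → ⊕-assoc
              }
            ; identity = (λ _ → ⊕-identityˡ) , (λ _ → ≋-trans ⊕-comm ⊕-identityˡ)
            }
          ; comm = λ _ _ → ⊕-comm
          }
        ; isPreleftSemimodule = record
          { *ₗ-cong = ⊛-cong
          ; *ₗ-zeroˡ = λ _ → ⊛-zeroˡ
          ; *ₗ-distribʳ = λ _ _ _ → ⊛-distribʳ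
          ; *ₗ-identityˡ = λ _ → ⊛-identityˡ
          ; *ₗ-assoc = λ _ _ _ → ⊛-assoc
          ; *ₗ-zeroʳ = λ _ → ⊛-zeroʳ
          ; *ₗ-distribˡ = λ _ _ _ → ⊛-distribˡ
          }
        }
      ; -ᴹ‿cong = ⊛-cong K.refl
      ; -ᴹ‿inverse = (λ _ → ⊕-inverseˡ) , (λ _ → ≋-trans ⊕-comm ⊕-inverseˡ)
      }
    }

  free : NSOperad K c (c ⊔ ℓ)
  free = record
    { space = termModule
    ; _∘[_]_by_ = _∘[_]_by_
    ; unit = unit
    ; ∘-cong = ∘-cong
    ; ∘-+ˡ = ∘-⊕ˡ
    ; ∘-+ʳ = ∘-⊕ʳ
    ; ∘-*ˡ = ∘-⊛ˡ
    ; ∘-*ʳ = ∘-⊛ʳ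
    ; ∘-identityˡ = ∘-identityˡ
    ; ∘-identityʳ = ∘-identityʳ
    ; ∘-assoc = ∘-assoc
    ; ∘-parallel = ∘-parallel
    }

  module _ {a ℓa} (P : NSOperad K a ℓa) (f : ∀ {n} → G n → NSOperad.Carrier P n) where
    private
      module P = NSOperad P
      module V n = LeftModule (P.space n)

    ⟦_⟧ : ∀ {n} → Term n → P.Carrier n
    ⟦ gen g ⟧           = f g
    ⟦ unit ⟧            = P.unit
    ⟦ x ∘[ i ] y by p ⟧ = ⟦ x ⟧ P.∘[ i ] ⟦ y ⟧ by p
    ⟦_⟧ {n} 𝟘           = V.0ᴹ n
    ⟦_⟧ {n} (x ⊕ y)     = V._+ᴹ_ n ⟦ x ⟧ ⟦ y ⟧
    ⟦_⟧ {n} (k ⊛ x)     = V._*ₗ_ n k ⟦ x ⟧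

    ⟦⟧-cong : ∀ {n} {x y : Term n} → x ≋ y → V._≈ᴹ_ n ⟦ x ⟧ ⟦ y ⟧
    ⟦⟧-cong {n} ≋-refl              = V.≈ᴹ-refl n
    ⟦⟧-cong {n} (≋-sym e)           = V.≈ᴹ-sym n (⟦⟧-cong e)
    ⟦⟧-cong {n} (≋-trans e e′)      = V.≈ᴹ-trans n (⟦⟧-cong e) (⟦⟧-cong e′)
    ⟦⟧-cong {n} (⊕-cong e e′)       = V.+ᴹ-cong n (⟦⟧-cong e) (⟦⟧-cong e′)
    ⟦⟧-cong {n} (⊛-cong e e′)       = V.*ₗ-cong n e (⟦⟧-cong e′)
    ⟦⟧-cong {n} ⊕-assoc             = V.+ᴹ-assoc n _ _ _
    ⟦⟧-cong {n} ⊕-comm              = V.+ᴹ-comm n _ _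
    ⟦⟧-cong {n} ⊕-identityˡ         = V.+ᴹ-identityˡ n _
    ⟦⟧-cong {n} ⊛-zeroˡ             = V.*ₗ-zeroˡ n _
    ⟦⟧-cong {n} ⊛-identityˡ         = V.*ₗ-identityˡ n _
    ⟦⟧-cong {n} ⊛-assoc             = V.*ₗ-assoc n _ _ _
    ⟦⟧-cong {n} ⊛-distribʳ          = V.*ₗ-distribʳ n _ _ _
    ⟦⟧-cong {n} ⊛-distribˡ          = V.*ₗ-distribˡ n _ _ _
    ⟦⟧-cong     (∘-cong e e′)       = P.∘-cong (⟦⟧-cong e) (⟦⟧-cong e′)
    ⟦⟧-cong     ∘-⊕ˡ                = P.∘-+ˡ
    ⟦⟧-cong     ∘-⊕ʳ                = P.∘-+ʳ
    ⟦⟧-cong     ∘-⊛ˡ                = P.∘-*ˡ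
    ⟦⟧-cong     ∘-⊛ʳ                = P.∘-*ʳ
    ⟦⟧-cong     ∘-identityˡ         = P.∘-identityˡ
    ⟦⟧-cong     ∘-identityʳ         = P.∘-identityʳ
    ⟦⟧-cong     (∘-assoc e)         = P.∘-assoc e
    ⟦⟧-cong     (∘-parallel e e′ e″) = P.∘-parallel e e′ e″

    private
      neg-homo : ∀ {n} (x : P.Carrier n) →
                 V._≈ᴹ_ n (V._*ₗ_ n (K.- K.1#) x) (V.-ᴹ_ n x)
      neg-homo {n} x = begin
        (K.- K.1#) *ₗ x                        ≈⟨ +ᴹ-identityʳ _ ⟨
        (K.- K.1#) *ₗ x +ᴹ 0ᴹ                  ≈⟨ +ᴹ-cong ≈ᴹ-refl (-ᴹ‿inverseʳ x) ⟨
        (K.- K.1#) *ₗ x +ᴹ (x +ᴹ (-ᴹ x))       ≈⟨ +ᴹ-assoc _ _ _ ⟨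
        ((K.- K.1#) *ₗ x +ᴹ x) +ᴹ (-ᴹ x)
          ≈⟨ +ᴹ-cong (+ᴹ-cong ≈ᴹ-refl (*ₗ-identityˡ x)) ≈ᴹ-refl ⟨
        ((K.- K.1#) *ₗ x +ᴹ K.1# *ₗ x) +ᴹ (-ᴹ x)
          ≈⟨ +ᴹ-cong (*ₗ-distribʳ x _ _) ≈ᴹ-refl ⟨
        ((K.- K.1#) K.+ K.1#) *ₗ x +ᴹ (-ᴹ x)
          ≈⟨ +ᴹ-cong (*ₗ-cong (K.-‿inverseˡ K.1#) ≈ᴹ-refl) ≈ᴹ-refl ⟩
        K.0# *ₗ x +ᴹ (-ᴹ x)                    ≈⟨ +ᴹ-cong (*ₗ-zeroˡ x) ≈ᴹ-refl ⟩
        0ᴹ +ᴹ (-ᴹ x)                           ≈⟨ +ᴹ-identityˡ _ ⟩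
        -ᴹ x                                   ∎
        where
        open LeftModule (P.space n)
        open SetoidReasoning ≈ᴹ-setoid

    lift : Morphism free P
    lift = record
      { ⟦_⟧ = ⟦_⟧
      ; isLeftModuleHomomorphism = λ n → record
        { +ᴹ-isGroupHomomorphism = record
          { isMonoidHomomorphism = record
            { isMagmaHomomorphism = record
              { isRelHomomorphism = record { cong = ⟦⟧-cong }
              ; homo = λ _ _ → V.≈ᴹ-refl n
              }
            ; ε-homo = V.≈ᴹ-refl n
            }
          ; ⁻¹-homo = λ x → neg-homo ⟦ x ⟧
          }
        ; *ₗ-homo = λ _ _ → V.≈ᴹ-refl n
        }
      ; ∘-homo = P.≈ᴹ-refl
      ; unit-homo = P.≈ᴹ-refl
      }

open FreeOperad using (free; lift) public

-- Elements are formal linear combinations, identified when each basis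
-- element has the same total coefficient in both.
module FreeModule {c ℓ} (K : CommutativeRing c ℓ) where
  open CommutativeRing K
    using (_≈_; 0#; 1#; -_; ring; setoid)
    renaming (Carrier to Scalar; _+_ to _⊹_; _*_ to _⋆_)
  private module K = CommutativeRing K

  Combination : Set → Set c
  Combination B = List (Scalar × B)

  scale : ∀ {B} → Scalar → Combination B → Combination B
  scale k = map λ (l , b) → k ⋆ l , b

  bilinear : ∀ {A B C} → (A → B → Combination C) →
             Combination A → Combination B → Combination C
  bilinear φ x y =
    concatMap (λ (k , a) → concatMap (λ (l , b) → scale (k ⋆ l) (φ a b)) y) x

  coefficient : ∀ {B} → DecidableEquality B → Combination B → B → Scalar
  coefficient _≟_ []            b = 0#
  coefficient _≟_ ((k , b′) ∷ x) b =
    (if does (b′ ≟ b) then k else 0#) ⊹ coefficient _≟_ x b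

  -- The value at x of the linear form that takes the values f on the basis.
  pair : ∀ {B : Set} → (B → Scalar) → Combination B → Scalar
  pair f []            = 0#
  pair f ((k , b) ∷ x) = k ⋆ f b ⊹ pair f x

  open SetoidReasoning setoid
  private
    open module CS = CommutativeSemigroupProperties K.+-commutativeSemigroup
      using (interchange; x∙yz≈y∙xz)
    open module CM = CommutativeSemigroupProperties K.*-commutativeSemigroup
      using () renaming (x∙yz≈y∙xz to x*yz≈y*xz)

  pair-cong : ∀ {B} {f g : B → Scalar} → (∀ b → f b ≈ g b) → ∀ x → pair f x ≈ pair g x
  pair-cong e []            = K.refl
  pair-cong e ((k , b) ∷ x) = K.+-cong (K.*-congˡ (e b)) (pair-cong e x)

  pair-++ : ∀ {B} (f : B → Scalar) x y → pair f (x ++ y) ≈ pair f x ⊹ pair f y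
  pair-++ f []            y = K.sym (K.+-identityˡ _)
  pair-++ f ((k , b) ∷ x) y = K.trans (K.+-congˡ (pair-++ f x y)) (K.sym (K.+-assoc _ _ _))

  pair-scale : ∀ {B} (f : B → Scalar) k x → pair f (scale k x) ≈ k ⋆ pair f x
  pair-scale f k []            = K.sym (K.zeroʳ k)
  pair-scale f k ((l , b) ∷ x) =
    K.trans (K.+-cong (K.*-assoc _ _ _) (pair-scale f k x)) (K.sym (K.distribˡ _ _ _))

  pair-zero : ∀ {B : Set} (x : Combination B) → pair (λ _ → 0#) x ≈ 0#
  pair-zero []            = K.refl
  pair-zero ((k , b) ∷ x) =
    K.trans (K.+-cong (K.zeroʳ k) (pair-zero x)) (K.+-identityˡ 0#)

  pair-+ : ∀ {B} (f g : B → Scalar) x → pair (λ b → f b ⊹ g b) x ≈ pair f x ⊹ pair g x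
  pair-+ f g []            = K.sym (K.+-identityˡ 0#)
  pair-+ f g ((k , b) ∷ x) =
    K.trans (K.+-cong (K.distribˡ _ _ _) (pair-+ f g x)) (interchange _ _ _ _)

  pair-* : ∀ {B} k (f : B → Scalar) x → pair (λ b → k ⋆ f b) x ≈ k ⋆ pair f x
  pair-* k f []            = K.sym (K.zeroʳ k)
  pair-* k f ((l , b) ∷ x) =
    K.trans (K.+-cong (x*yz≈y*xz _ _ _) (pair-* k f x)) (K.sym (K.distribˡ _ _ _))

  pair-swap : ∀ {A B} (f : A → B → Scalar) x y →
              pair (λ a → pair (f a) y) x ≈ pair (λ b → pair (λ a → f a b) x) y
  pair-swap f []            y = K.sym (pair-zero y)
  pair-swap f ((k , a) ∷ x) y = begin
    k ⋆ pair (f a) y ⊹ pair (λ a → pair (f a) y) x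
      ≈⟨ K.+-cong (K.sym (pair-* k (f a) y)) (pair-swap f x y) ⟩
    pair (λ b → k ⋆ f a b) y ⊹ pair (λ b → pair (λ a → f a b) x) y
      ≈⟨ pair-+ _ _ y ⟨
    pair (λ b → k ⋆ f a b ⊹ pair (λ a → f a b) x) y ∎

  pair-bilinear : ∀ {A B C} (φ : A → B → Combination C) f x y →
                  pair f (bilinear φ x y) ≈ pair (λ a → pair (λ b → pair f (φ a b)) y) x
  pair-bilinear φ f []            y = K.refl
  pair-bilinear φ f ((k , a) ∷ x) y =
    K.trans (pair-++ f (concatMap _ y) _) (K.+-cong (row y) (pair-bilinear φ f x y))
    where
    row : ∀ y → pair f (concatMap (λ (l , b) → scale (k ⋆ l) (φ a b)) y) ≈
                k ⋆ pair (λ b → pair f (φ a b)) y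
    row []            = K.sym (K.zeroʳ k)
    row ((l , b) ∷ y) = begin
      pair f (scale (k ⋆ l) (φ a b) ++ _)
        ≈⟨ pair-++ f (scale (k ⋆ l) (φ a b)) _ ⟩
      pair f (scale (k ⋆ l) (φ a b)) ⊹ _
        ≈⟨ K.+-cong (K.trans (pair-scale f (k ⋆ l) (φ a b)) (K.*-assoc _ _ _)) (row y) ⟩
      k ⋆ (l ⋆ pair f (φ a b)) ⊹ k ⋆ pair (λ b → pair f (φ a b)) y
        ≈⟨ K.distribˡ _ _ _ ⟨
      k ⋆ (l ⋆ pair f (φ a b) ⊹ pair (λ b → pair f (φ a b)) y) ∎

  module _ {B : Set} (_≟_ : DecidableEquality B) where
    infix 4 _≃_
    record _≃_ (x y : Combination B) : Set ℓ where
      constructor mk≃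
      field coefficient≈ : ∀ b → coefficient _≟_ x b ≈ coefficient _≟_ y b

    open _≃_

    private
      indicator : B → B → Scalar
      indicator b b′ = if does (b′ ≟ b) then 1# else 0#

      coefficient≈pair : ∀ x b → coefficient _≟_ x b ≈ pair (indicator b) x
      coefficient≈pair []             b = K.refl
      coefficient≈pair ((k , b′) ∷ x) b =
        K.+-cong (branch (does (b′ ≟ b))) (coefficient≈pair x b)
        where
        branch : ∀ t → (if t then k else 0#) ≈ k ⋆ (if t then 1# else 0#)
        branch true  = K.sym (K.*-identityʳ k)
        branch false = K.sym (K.zeroʳ k)

      remove : B → Combination B → Combination B
      remove b []             = []
      remove b ((k , b′) ∷ x) = if does (b′ ≟ b) then remove b x else (k , b′) ∷ remove b x

      length-remove : ∀ b x → length (remove b x) ≤ length x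
      length-remove b []             = z≤n
      length-remove b ((k , b′) ∷ x) with does (b′ ≟ b)
      ... | true  = ℕₚ.m≤n⇒m≤1+n (length-remove b x)
      ... | false = s≤s (length-remove b x)

      pair-remove : ∀ f b x → pair f x ≈ coefficient _≟_ x b ⋆ f b ⊹ pair f (remove b x)
      pair-remove f b []             = K.sym (K.trans (K.+-identityʳ _) (K.zeroˡ _))
      pair-remove f b ((k , b′) ∷ x) with b′ ≟ b
      ... | yes refl = begin
        k ⋆ f b ⊹ pair f x
          ≈⟨ K.+-congˡ (pair-remove f b x) ⟩
        k ⋆ f b ⊹ (coefficient _≟_ x b ⋆ f b ⊹ pair f (remove b x))
          ≈⟨ K.+-assoc _ _ _ ⟨
        (k ⋆ f b ⊹ coefficient _≟_ x b ⋆ f b) ⊹ pair f (remove b x)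
          ≈⟨ K.+-congʳ (K.distribʳ _ _ _) ⟨
        (k ⊹ coefficient _≟_ x b) ⋆ f b ⊹ pair f (remove b x) ∎
      ... | no _ = begin
        k ⋆ f b′ ⊹ pair f x
          ≈⟨ K.+-congˡ (pair-remove f b x) ⟩
        k ⋆ f b′ ⊹ (coefficient _≟_ x b ⋆ f b ⊹ pair f (remove b x))
          ≈⟨ x∙yz≈y∙xz _ _ _ ⟩
        coefficient _≟_ x b ⋆ f b ⊹ (k ⋆ f b′ ⊹ pair f (remove b x))
          ≈⟨ K.+-congʳ (K.*-congʳ (K.+-identityˡ _)) ⟨
        (0# ⊹ coefficient _≟_ x b) ⋆ f b ⊹ (k ⋆ f b′ ⊹ pair f (remove b x)) ∎

      coefficient-remove-≡ : ∀ b x → coefficient _≟_ (remove b x) b ≈ 0#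
      coefficient-remove-≡ b []             = K.refl
      coefficient-remove-≡ b ((k , b′) ∷ x) with b′ ≟ b in eq
      ... | yes _ = coefficient-remove-≡ b x
      ... | no _ rewrite eq = K.trans (K.+-identityˡ _) (coefficient-remove-≡ b x)

      coefficient-remove-≢ : ∀ {b d} → b ≢ d → ∀ x →
                             coefficient _≟_ (remove b x) d ≈ coefficient _≟_ x d
      coefficient-remove-≢ b≢d []             = K.refl
      coefficient-remove-≢ {b} {d} b≢d ((k , b′) ∷ x) with b′ ≟ b
      ... | no _ = K.+-congˡ (coefficient-remove-≢ b≢d x)
      ... | yes refl with b ≟ d
      ...   | yes b≡d = contradiction b≡d b≢d
      ...   | no _    = K.trans (coefficient-remove-≢ b≢d x) (K.sym (K.+-identityˡ _))

      pair-vanish : ∀ f n x → length x ≤ n → x ≃ [] → pair f x ≈ 0#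
      pair-vanish f n []                  _       _ = K.refl
      pair-vanish f (suc n) x@((k , b) ∷ x′) (s≤s le) e = begin
        pair f x
          ≈⟨ pair-remove f b x ⟩
        coefficient _≟_ x b ⋆ f b ⊹ pair f (remove b x)
          ≈⟨ K.+-cong (K.trans (K.*-congʳ (coefficient≈ e b)) (K.zeroˡ _))
                      (pair-vanish f n (remove b x) shorter vanishes) ⟩
        0# ⊹ 0#
          ≈⟨ K.+-identityˡ 0# ⟩
        0# ∎
        where
        shorter : length (remove b x) ≤ n
        shorter with b ≟ b
        ... | yes _   = ℕₚ.≤-trans (length-remove b x′) le
        ... | no b≢b = contradiction refl b≢b

        vanishes : remove b x ≃ []
        coefficient≈ vanishes d with b ≟ d
        ... | yes refl = coefficient-remove-≡ b x
        ... | no b≢d   = K.trans (coefficient-remove-≢ b≢d x) (coefficient≈ e d)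

      coefficient-++ : ∀ x y b → coefficient _≟_ (x ++ y) b ≈
                                 coefficient _≟_ x b ⊹ coefficient _≟_ y b
      coefficient-++ x y b = begin
        coefficient _≟_ (x ++ y) b
          ≈⟨ coefficient≈pair (x ++ y) b ⟩
        pair (indicator b) (x ++ y)
          ≈⟨ pair-++ (indicator b) x y ⟩
        pair (indicator b) x ⊹ pair (indicator b) y
          ≈⟨ K.+-cong (coefficient≈pair x b) (coefficient≈pair y b) ⟨
        coefficient _≟_ x b ⊹ coefficient _≟_ y b ∎

      coefficient-scale : ∀ k x b → coefficient _≟_ (scale k x) b ≈ k ⋆ coefficient _≟_ x b
      coefficient-scale k x b = begin
        coefficient _≟_ (scale k x) b   ≈⟨ coefficient≈pair (scale k x) b ⟩
        pair (indicator b) (scale k x)  ≈⟨ pair-scale (indicator b) k x ⟩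
        k ⋆ pair (indicator b) x        ≈⟨ K.*-congˡ (coefficient≈pair x b) ⟨
        k ⋆ coefficient _≟_ x b         ∎

      neg-inverseˡ : ∀ k → (- 1#) ⋆ k ⊹ k ≈ 0#
      neg-inverseˡ k =
        K.trans (K.+-congʳ (RingProperties.-1*x≈-x ring k)) (K.-‿inverseˡ k)

      ++-inverseˡ : ∀ x → scale (- 1#) x ++ x ≃ []
      coefficient≈ (++-inverseˡ x) b =
        K.trans (coefficient-++ (scale (- 1#) x) x b)
        (K.trans (K.+-congʳ (coefficient-scale (- 1#) x b)) (neg-inverseˡ _))

      ++-comm : ∀ x y → x ++ y ≃ y ++ x
      coefficient≈ (++-comm x y) b =
        K.trans (coefficient-++ x y b)
        (K.trans (K.+-comm _ _) (K.sym (coefficient-++ y x b)))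

      ++-cong : ∀ {x x′ y y′} → x ≃ x′ → y ≃ y′ → x ++ y ≃ x′ ++ y′
      coefficient≈ (++-cong {x} {x′} {y} {y′} e e′) b =
        K.trans (coefficient-++ x y b)
        (K.trans (K.+-cong (coefficient≈ e b) (coefficient≈ e′ b)) (K.sym (coefficient-++ x′ y′ b)))

      scale-cong : ∀ {k k′ x x′} → k ≈ k′ → x ≃ x′ → scale k x ≃ scale k′ x′
      coefficient≈ (scale-cong {k} {k′} {x} {x′} e e′) b =
        K.trans (coefficient-scale k x b)
        (K.trans (K.*-cong e (coefficient≈ e′ b)) (K.sym (coefficient-scale k′ x′ b)))

    ≃⇒pair≈ : ∀ {x y} → x ≃ y → ∀ f → pair f x ≈ pair f y
    ≃⇒pair≈ {x} {y} e f = begin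
      pair f x
        ≈⟨ K.+-identityʳ _ ⟨
      pair f x ⊹ 0#
        ≈⟨ K.+-congˡ (neg-inverseˡ _) ⟨
      pair f x ⊹ ((- 1#) ⋆ pair f y ⊹ pair f y)
        ≈⟨ K.+-assoc _ _ _ ⟨
      (pair f x ⊹ (- 1#) ⋆ pair f y) ⊹ pair f y
        ≈⟨ K.+-congʳ (K.+-congˡ (pair-scale f (- 1#) y)) ⟨
      (pair f x ⊹ pair f (scale (- 1#) y)) ⊹ pair f y
        ≈⟨ K.+-congʳ (pair-++ f x (scale (- 1#) y)) ⟨
      pair f (x ++ scale (- 1#) y) ⊹ pair f y
        ≈⟨ K.+-congʳ (pair-vanish f _ (x ++ scale (- 1#) y) ℕₚ.≤-refl difference) ⟩
      0# ⊹ pair f y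
        ≈⟨ K.+-identityˡ _ ⟩
      pair f y ∎
      where
      difference : x ++ scale (- 1#) y ≃ []
      coefficient≈ difference b =
        K.trans (coefficient≈ (++-cong {y = scale (- 1#) y} e (mk≃ λ _ → K.refl)) b)
        (K.trans (coefficient≈ (++-comm y (scale (- 1#) y)) b)
          (coefficient≈ (++-inverseˡ y) b))

    pair≈⇒≃ : ∀ {x y} → (∀ f → pair f x ≈ pair f y) → x ≃ y
    coefficient≈ (pair≈⇒≃ {x} {y} e) b =
      K.trans (coefficient≈pair x b) (K.trans (e (indicator b)) (K.sym (coefficient≈pair y b)))

    freeModule : LeftModule ring c ℓ
    freeModule = record
      { Carrierᴹ = Combination B
      ; _≈ᴹ_ = _≃_
      ; _+ᴹ_ = _++_
      ; _*ₗ_ = scale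
      ; 0ᴹ = []
      ; -ᴹ_ = scale (- 1#)
      ; isLeftModule = record
        { isLeftSemimodule = record
          { +ᴹ-isCommutativeMonoid = record
            { isMonoid = record
              { isSemigroup = record
                { isMagma = record
                  { isEquivalence = record
                    { refl = mk≃ λ _ → K.refl
                    ; sym = λ e → mk≃ λ b → K.sym (coefficient≈ e b)
                    ; trans = λ e e′ → mk≃ λ b → K.trans (coefficient≈ e b) (coefficient≈ e′ b)
                    }
                  ; ∙-cong = ++-cong
                  }
                ; assoc = λ x y z → mk≃ λ b →
                    K.reflexive (cong (λ w → coefficient _≟_ w b) (++-assoc x y z))
                }
              ; identity = (λ _ → mk≃ λ _ → K.refl)
                         , λ x → mk≃ λ b →
                             K.reflexive (cong (λ w → coefficient _≟_ w b) (++-identityʳ x))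
              }
            ; comm = ++-comm
            }
          ; isPreleftSemimodule = record
            { *ₗ-cong = scale-cong
            ; *ₗ-zeroˡ = λ x → mk≃ λ b → K.trans (coefficient-scale 0# x b) (K.zeroˡ _)
            ; *ₗ-distribʳ = λ x k l → mk≃ λ b →
                K.trans (coefficient-scale (k ⊹ l) x b)
                (K.trans (K.distribʳ _ _ _)
                (K.sym (K.trans (coefficient-++ (scale k x) (scale l x) b)
                  (K.+-cong (coefficient-scale k x b) (coefficient-scale l x b)))))
            ; *ₗ-identityˡ = λ x → mk≃ λ b →
                K.trans (coefficient-scale 1# x b) (K.*-identityˡ _)
            ; *ₗ-assoc = λ k l x → mk≃ λ b →
                K.trans (coefficient-scale (k ⋆ l) x b)
                (K.trans (K.*-assoc _ _ _)
                (K.sym (K.trans (coefficient-scale k (scale l x) b)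
                  (K.*-congˡ (coefficient-scale l x b)))))
            ; *ₗ-zeroʳ = λ _ → mk≃ λ _ → K.refl
            ; *ₗ-distribˡ = λ k x y → mk≃ λ b →
                K.trans (coefficient-scale k (x ++ y) b)
                (K.trans (K.*-congˡ (coefficient-++ x y b))
                (K.trans (K.distribˡ _ _ _)
                (K.sym (K.trans (coefficient-++ (scale k x) (scale k y) b)
                  (K.+-cong (coefficient-scale k x b) (coefficient-scale k y b))))))
            }
          }
        ; -ᴹ‿cong = scale-cong K.refl
        ; -ᴹ‿inverse = ++-inverseˡ
                     , λ x → mk≃ λ b →
                         K.trans (coefficient≈ (++-comm x (scale (- 1#) x)) b)
                           (coefficient≈ (++-inverseˡ x) b)
        }
      }

RangeMap : Set
RangeMap = (i : ℕ) → .{{NonZero i}} → ℕ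

Unimodal : RangeMap → Set
Unimodal δ = ∀ i₁ i₂ i₃ .{{_ : NonZero i₁}} .{{_ : NonZero i₂}} .{{_ : NonZero i₃}} →
             i₁ < i₂ → i₂ < i₃ → ¬ (δ i₁ > δ i₂ × δ i₂ < δ i₃)

OneDominated : RangeMap → Set
OneDominated δ = ∃[ k ] (1 ≤ k × (∀ k′ .{{_ : NonZero k′}} → k ≤ k′ → δ k′ ≤ δ 1))

Word : Set
Word = List ℕ

∣_∣ : Word → ℕ
∣ w ∣ = suc (length w)

-- Positions are numbered from 1 here: 1 ≤ i ≤ ∣ u ∣.
infix 8 _□[_]_
_□[_]_ : Word → ℕ → Word → Word
u □[ i ] v = take (i ∸ 1) u ++ v ++ drop (i ∸ 1) u

IsCliff : RangeMap → Word → Set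
IsCliff δ w = ∀ (i : Fin (length w)) → lookup w i ≤ δ (suc (toℕ i))

isCliff? : ∀ δ w → Dec (IsCliff δ w)
isCliff? δ w = all? λ i → lookup w i ℕₚ.≤? δ (suc (toℕ i))

record IsPrime (δ : RangeMap) (w : Word) : Set where
  field
    nonempty       : w ≢ []
    isCliff        : IsCliff δ w
    indecomposable : ∀ u v i → IsCliff δ u → IsCliff δ v → 1 ≤ i → i ≤ ∣ u ∣ →
                     w ≡ u □[ i ] v → (u ≡ w × v ≡ []) ⊎ (u ≡ [] × v ≡ w)

-- Proof fields are irrelevant here and in Generator, so that elements with
-- the same word are equal.
record Cliff (δ : RangeMap) (n : ℕ) : Set where
  constructor mkCliff
  field
    word     : Word
    .isCliff : IsCliff δ word
    .size    : ∣ word ∣ ≡ n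

-- Basis elements of the generating set 𝔊 of arity n.
record Generator (δ : RangeMap) (n : ℕ) : Set where
  constructor mkGenerator
  field
    word     : Word
    .isPrime : IsPrime δ word
    .size    : ∣ word ∣ ≡ n

cliff : ∀ {δ n} → Generator δ n → Cliff δ n
cliff (mkGenerator w p s) = mkCliff w (IsPrime.isCliff p) s

open Cliff using (word)

word-injective : ∀ {δ n} {u v : Cliff δ n} → word u ≡ word v → u ≡ v
word-injective refl = refl

word-size : ∀ {δ n} (u : Cliff δ n) → ∣ word u ∣ ≡ n
word-size (mkCliff w _ s) = recompute (∣ w ∣ ℕₚ.≟ _) s

_≟ᶜ_ : ∀ {δ n} → DecidableEquality (Cliff δ n)
u ≟ᶜ v = map′ word-injective (cong word) (≡-dec ℕₚ._≟_ (word u) (word v))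

length-□ : ∀ u i v → length (u □[ i ] v) ≡ length u + length v
length-□ u i v = begin
  length (a ++ v ++ b)              ≡⟨ length-++ a ⟩
  length a + length (v ++ b)        ≡⟨ cong (length a +_) (length-++ v) ⟩
  length a + (length v + length b)  ≡⟨ cong (length a +_) (ℕₚ.+-comm (length v) _) ⟩
  length a + (length b + length v)  ≡⟨ ℕₚ.+-assoc (length a) _ _ ⟨
  length a + length b + length v    ≡⟨ cong (_+ length v) (length-++ a) ⟨
  length (a ++ b) + length v        ≡⟨ cong (λ w → length w + length v) (take++drop≡id (i ∸ 1) u) ⟩
  length u + length v               ∎
  where
  open ≡-Reasoning
  a = take (i ∸ 1) u
  b = drop (i ∸ 1) u

size-□ : ∀ {m n r} u i v → .(∣ u ∣ ≡ m) → .(∣ v ∣ ≡ n) → .(suc r ≡ m + n) →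
         ∣ u □[ i ] v ∣ ≡ r
size-□ u i v s t p = recompute (_ ℕₚ.≟ _) (lemma s t p)
  where
  lemma : ∀ {m n r} → ∣ u ∣ ≡ m → ∣ v ∣ ≡ n → suc r ≡ m + n → ∣ u □[ i ] v ∣ ≡ r
  lemma refl refl p =
    trans (cong suc (length-□ u i v))
          (sym (ℕₚ.suc-injective (trans p (cong suc (ℕₚ.+-suc (length u) (length v))))))

private
  split : ∀ k (u : Word) → k ≤ length u → ∃[ a ] ∃[ b ] (u ≡ a ++ b × length a ≡ k)
  split k u k≤u = take k u , drop k u , sym (take++drop≡id k u)
                , trans (length-take k u) (ℕₚ.m≤n⇒m⊓n≡m k≤u)

  take-length : ∀ (a b : Word) → take (length a) (a ++ b) ≡ a
  take-length []      b = refl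
  take-length (x ∷ a) b = cong (x ∷_) (take-length a b)

  drop-length : ∀ (a b : Word) → drop (length a) (a ++ b) ≡ b
  drop-length []      b = refl
  drop-length (x ∷ a) b = drop-length a b

  □-++ : ∀ {u k} a b v → u ≡ a ++ b → k ≡ length a → u □[ suc k ] v ≡ a ++ v ++ b
  □-++ a b v refl refl = cong₂ (λ s t → s ++ v ++ t) (take-length a b) (drop-length a b)

  position≤length : ∀ {m k} (u : Word) → ∣ u ∣ ≡ m → k < m → k ≤ length u
  position≤length u refl (s≤s k≤u) = k≤u

module _ (δ : RangeMap) where
  private
    -- The letters of w do not exceed the bounds δ(k+1), δ(k+2), ….
    data Fits : ℕ → Word → Set where
      []  : ∀ {k} → Fits k []
      _∷_ : ∀ {k x w} → x ≤ δ (suc k) → Fits (suc k) w → Fits k (x ∷ w)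

    δ-cong : ∀ {a k l} → k ≡ l → a ≤ δ (suc k) → a ≤ δ (suc l)
    δ-cong refl p = p

    fits : ∀ k w → (∀ i → lookup w i ≤ δ (suc (k + toℕ i))) → Fits k w
    fits k []      f = []
    fits k (x ∷ w) f =
      δ-cong (ℕₚ.+-identityʳ k) (f zero) ∷
      fits (suc k) w (λ i → δ-cong (ℕₚ.+-suc k (toℕ i)) (f (suc i)))

    unfits : ∀ k w → Fits k w → ∀ i → lookup w i ≤ δ (suc (k + toℕ i))
    unfits k (x ∷ w) (p ∷ ps) zero    = δ-cong (sym (ℕₚ.+-identityʳ k)) p
    unfits k (x ∷ w) (p ∷ ps) (suc i) =
      δ-cong (sym (ℕₚ.+-suc k (toℕ i))) (unfits (suc k) w ps i)

    fits-++⁻ : ∀ {k} a {b} → Fits k (a ++ b) → Fits k a × Fits (length a + k) b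
    fits-++⁻ []      ps       = [] , ps
    fits-++⁻ {k} (x ∷ a) {b} (p ∷ ps) with fits-++⁻ a ps
    ... | qs , rs = p ∷ qs , subst (λ n → Fits n b) (ℕₚ.+-suc (length a) k) rs

    fits-++⁺ : ∀ {k} a {b} → Fits k a → Fits (length a + k) b → Fits k (a ++ b)
    fits-++⁺ []      _        rs = rs
    fits-++⁺ {k} (x ∷ a) {b} (p ∷ qs) rs =
      p ∷ fits-++⁺ a qs (subst (λ n → Fits n b) (sym (ℕₚ.+-suc (length a) k)) rs)

  relevant : ∀ {n} (u : Cliff δ n) → IsCliff δ (word u)
  relevant (mkCliff w p _) = recompute (isCliff? δ w) p

  position : ∀ {m} (u : Cliff δ m) (i : Fin m) → toℕ i ≤ length (word u)
  position u i = position≤length (word u) (word-size u) (toℕ<n i)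

  module _ (unimodal : Unimodal δ) where
    private
      between : ∀ {a k l m} → k ≤ l → l ≤ m →
                a ≤ δ (suc k) → a ≤ δ (suc m) → a ≤ δ (suc l)
      between {a} {k} {l} {m} k≤l l≤m p q with a ℕₚ.≤? δ (suc l)
      ... | yes r = r
      ... | no ¬r with k ℕₚ.≟ l | l ℕₚ.≟ m
      ...   | yes refl | _        = contradiction p ¬r
      ...   | no _     | yes refl = contradiction q ¬r
      ...   | no k≢l   | no l≢m   = contradiction
        (ℕₚ.<-≤-trans (ℕₚ.≰⇒> ¬r) p , ℕₚ.<-≤-trans (ℕₚ.≰⇒> ¬r) q)
        (unimodal (suc k) (suc l) (suc m)
          (s≤s (ℕₚ.≤∧≢⇒< k≤l k≢l)) (s≤s (ℕₚ.≤∧≢⇒< l≤m l≢m)))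

      fits-between : ∀ {k l m w} → Fits k w → Fits m w → k ≤ l → l ≤ m → Fits l w
      fits-between []       []       k≤l l≤m = []
      fits-between (p ∷ ps) (q ∷ qs) k≤l l≤m =
        between k≤l l≤m p q ∷ fits-between ps qs (s≤s k≤l) (s≤s l≤m)

      shift : ∀ (w : Word) {n} → n ≤ length w + n
      shift w = ℕₚ.m≤n+m _ (length w)

      length-insert : ∀ (c w d : Word) → length (c ++ d) ≤ length (c ++ w ++ d)
      length-insert []      w d = ℕₚ.≤-trans (ℕₚ.m≤n+m _ (length w))
                                    (ℕₚ.≤-reflexive (sym (length-++ w)))
      length-insert (x ∷ c) w d = s≤s (length-insert c w d)

      fits-assoc : ∀ a b c d w → Fits 0 (a ++ b) → Fits 0 (c ++ d) → Fits 0 w →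
                   Fits 0 (a ++ (c ++ w ++ d) ++ b) →
                   Fits 0 (a ++ (c ++ d) ++ b) × Fits 0 (c ++ w ++ d)
      fits-assoc a b c d w U V W T
        with Ua , Ub ← fits-++⁻ a U
           | Vc , Vd ← fits-++⁻ c V
           | Ta , T₁ ← fits-++⁻ a T
        with T₂ , Tb ← fits-++⁻ (c ++ w ++ d) T₁
        with Tc , T₃ ← fits-++⁻ c T₂
        with Tw , Td ← fits-++⁻ w T₃
        = fits-++⁺ a Ua (fits-++⁺ (c ++ d)
            (fits-++⁺ c Tc
              (fits-between Vd Td (ℕₚ.+-monoʳ-≤ (length c) z≤n) (shift w)))
            (fits-between Ub Tb (shift (c ++ d))
              (ℕₚ.+-monoˡ-≤ (length a + 0) (length-insert c w d))))
        , fits-++⁺ c Vc (fits-++⁺ w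
            (fits-between W Tw z≤n (ℕₚ.+-monoʳ-≤ (length c) z≤n))
            (fits-between Vd Td (shift w)
              (ℕₚ.+-monoʳ-≤ (length w) (ℕₚ.+-monoʳ-≤ (length c) z≤n))))

      fits-parallel : ∀ a b c v w → Fits 0 (a ++ b ++ c) → Fits 0 v → Fits 0 w →
                      Fits 0 (a ++ v ++ b ++ w ++ c) →
                      Fits 0 (a ++ v ++ b ++ c) × Fits 0 (a ++ b ++ w ++ c)
      fits-parallel a b c v w U V W T
        with Ua , U₁ ← fits-++⁻ a U
           | Ta , T₁ ← fits-++⁻ a T
        with Ub , Uc ← fits-++⁻ b U₁
           | Tv , T₂ ← fits-++⁻ v T₁
        with Tb , T₃ ← fits-++⁻ b T₂
        with Tw , Tc ← fits-++⁻ w T₃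
        = fits-++⁺ a Ua (fits-++⁺ v Tv (fits-++⁺ b Tb
            (fits-between Uc Tc (ℕₚ.+-monoʳ-≤ (length b) (shift v)) (shift w))))
        , fits-++⁺ a Ua (fits-++⁺ b Ub (fits-++⁺ w
            (fits-between W Tw z≤n (ℕₚ.+-monoʳ-≤ (length b) (shift v)))
            (fits-between Uc Tc (shift w)
              (ℕₚ.+-monoʳ-≤ (length w) (ℕₚ.+-monoʳ-≤ (length b) (shift v))))))

    module _ {m n : ℕ} (u : Cliff δ m) (v : Cliff δ n) (w : Word) (W : IsCliff δ w)
             {i j k : ℕ} (i≤ : i ≤ length (word u)) (j≤ : j ≤ length (word v))
             (k≡ : k ≡ i + j) where
      private
        uv = word u □[ suc i ] word v
        vw = word v □[ suc j ] w

      □-assoc : uv □[ suc k ] w ≡ word u □[ suc i ] vw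
      □-assoc
        with a , b , u≡ , refl ← split i (word u) i≤
        with c , d , v≡ , refl ← split j (word v) j≤
        = trans
            (□-++ (a ++ c) (d ++ b) w
              (trans (□-++ a b _ u≡ refl)
                (trans (cong (λ t → a ++ t ++ b) v≡)
                  (trans (cong (a ++_) (++-assoc c d b)) (sym (++-assoc a c (d ++ b))))))
              (trans k≡ (sym (length-++ a))))
            (trans (++-assoc a c (w ++ d ++ b))
              (trans
                (cong (a ++_)
                  (trans (cong (c ++_) (sym (++-assoc w d b)))
                    (sym (++-assoc c (w ++ d) b))))
                (trans (cong (λ t → a ++ t ++ b) (sym (□-++ c d w v≡ refl)))
                  (sym (□-++ a b _ u≡ refl)))))

      cliff-assoc : IsCliff δ (word u □[ suc i ] vw) → IsCliff δ uv × IsCliff δ vw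
      cliff-assoc T
        with a , b , u≡ , refl ← split i (word u) i≤
        with c , d , v≡ , refl ← split j (word v) j≤
        with F , F′ ← fits-assoc a b c d w
               (subst (Fits 0) u≡ (fits 0 _ (relevant u)))
               (subst (Fits 0) v≡ (fits 0 _ (relevant v)))
               (fits 0 _ W)
               (subst (Fits 0)
                 (trans (□-++ a b _ u≡ refl)
                   (cong (λ t → a ++ t ++ b) (□-++ c d w v≡ refl)))
                 (fits 0 _ T))
        = unfits 0 _ (subst (Fits 0)
            (sym (trans (□-++ a b _ u≡ refl) (cong (λ t → a ++ t ++ b) v≡))) F)
        , unfits 0 _ (subst (Fits 0) (sym (□-++ c d w v≡ refl)) F′)

    module _ {m : ℕ} (u : Cliff δ m) (v w : Word) (V : IsCliff δ v) (W : IsCliff δ w)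
             {i j k : ℕ} (i≤j : i ≤ j) (j≤ : j ≤ length (word u))
             (k≡ : k ≡ j + length v) where
      private
        uv = word u □[ suc i ] v
        uw = word u □[ suc j ] w

        parts : ∃[ a ] ∃[ b ] ∃[ c ]
                (word u ≡ a ++ b ++ c × length a ≡ i × length (a ++ b) ≡ j)
        parts
          with e , c , u≡ , e≡ ← split j (word u) j≤
          with a , b , e≡ab , a≡ ← split i e (ℕₚ.≤-trans i≤j (ℕₚ.≤-reflexive (sym e≡)))
          = a , b , c , trans u≡ (trans (cong (_++ c) e≡ab) (++-assoc a b c))
          , a≡ , trans (cong length (sym e≡ab)) e≡

      □-parallel : uv □[ suc k ] w ≡ uw □[ suc i ] v
      □-parallel with a , b , c , u≡ , refl , refl ← parts
        = trans
            (□-++ (a ++ v ++ b) c w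
              (trans (□-++ a (b ++ c) v u≡ refl)
                (trans (cong (a ++_) (sym (++-assoc v b c))) (sym (++-assoc a (v ++ b) c))))
              (trans k≡ lengths))
            (trans
              (trans (++-assoc a (v ++ b) (w ++ c)) (cong (a ++_) (++-assoc v b (w ++ c))))
              (sym (□-++ a (b ++ w ++ c) v
                (trans (□-++ (a ++ b) c w (trans u≡ (sym (++-assoc a b c))) refl)
                  (++-assoc a b (w ++ c)))
                refl)))
        where
        lengths : length (a ++ b) + length v ≡ length (a ++ v ++ b)
        lengths = trans (cong (_+ length v) (length-++ a))
          (trans (ℕₚ.+-assoc (length a) _ _)
            (trans (cong (length a +_)
                     (trans (ℕₚ.+-comm (length b) _) (sym (length-++ v))))
              (sym (length-++ a))))

      cliff-parallel : IsCliff δ (uv □[ suc k ] w) → IsCliff δ uv × IsCliff δ uw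
      cliff-parallel T with a , b , c , u≡ , refl , refl ← parts
        with F , F′ ← fits-parallel a b c v w
               (subst (Fits 0) u≡ (fits 0 _ (relevant u)))
               (fits 0 _ V) (fits 0 _ W)
               (subst (Fits 0)
                 (trans □-parallel
                   (□-++ a (b ++ w ++ c) v
                     (trans (□-++ (a ++ b) c w (trans u≡ (sym (++-assoc a b c))) refl)
                       (++-assoc a b (w ++ c)))
                     refl))
                 (fits 0 _ T))
        = unfits 0 _ (subst (Fits 0) (sym (□-++ a (b ++ c) v u≡ refl)) F)
        , unfits 0 _ (subst (Fits 0)
            (sym (trans (□-++ (a ++ b) c w (trans u≡ (sym (++-assoc a b c))) refl)
                   (++-assoc a b (w ++ c)))) F′)

module CliffOperad {c ℓ} (K : CommutativeRing c ℓ) (δ : RangeMap) where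
  open CommutativeRing K using (_≈_; 1#; setoid) renaming (Carrier to Scalar; _*_ to _⋆_)
  open FreeModule K hiding (_≃_)
  private module K = CommutativeRing K

  Element : ℕ → Set c
  Element n = Combination (Cliff δ n)

  E : ∀ {n} → Cliff δ n → Element n
  E w = (1# , w) ∷ []

  E-or-0 : ∀ {n} (w : Word) → .(∣ w ∣ ≡ n) → Element n
  E-or-0 w s with isCliff? δ w
  ... | yes p = E (mkCliff w p s)
  ... | no _  = []

  composeBasis : ∀ {m n r} → Fin m → .(suc r ≡ m + n) → Cliff δ m → Cliff δ n → Element r
  composeBasis i p (mkCliff u _ s) (mkCliff v _ t) =
    E-or-0 (u □[ suc (toℕ i) ] v) (size-□ u (suc (toℕ i)) v s t p)

  compose : ∀ {m n r} → Element m → Fin m → Element n → .(suc r ≡ m + n) → Element r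
  compose x i y p = bilinear (composeBasis i p) x y

  ε : Cliff δ 1
  ε = mkCliff [] (λ ()) refl

  module _ (unimodal : Unimodal δ) where
    private
      open SetoidReasoning setoid

      infix 4 _≃_
      _≃_ : ∀ {n} → Element n → Element n → Set ℓ
      _≃_ = FreeModule._≃_ K _≟ᶜ_

      ext : ∀ {n} {x y : Element n} → (∀ f → pair f x ≈ pair f y) → x ≃ y
      ext = pair≈⇒≃ _≟ᶜ_

      pair-E : ∀ {n} (f : Cliff δ n → Scalar) w → pair f (E w) ≈ f w
      pair-E f w = K.trans (K.+-identityʳ _) (K.*-identityˡ _)

      pair-cliff : ∀ {n} (f : Cliff δ n → Scalar) (u : Cliff δ n) {w} .(s : ∣ w ∣ ≡ n) →
                   w ≡ word u → pair f (E-or-0 w s) ≈ f u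
      pair-cliff f u {w} s refl with isCliff? δ w
      ... | yes p = pair-E f u
      ... | no ¬p = contradiction (relevant δ u) ¬p

      pair-nested : ∀ {m n} (f : Cliff δ n → Scalar) (g : Cliff δ m → Scalar) (w t : Word)
                    .(s : ∣ w ∣ ≡ m) .(s′ : ∣ t ∣ ≡ n) → (IsCliff δ t → IsCliff δ w) →
                    (∀ p → g (mkCliff w p s) ≈ pair f (E-or-0 t s′)) →
                    pair g (E-or-0 w s) ≈ pair f (E-or-0 t s′)
      pair-nested f g w t s s′ h e with isCliff? δ w
      ... | yes p = K.trans (pair-E g (mkCliff w p s)) (e p)
      ... | no ¬p with isCliff? δ t
      ...   | yes q = contradiction (h q) ¬p
      ...   | no _  = K.refl

      E-or-0-cong : ∀ {n} (f : Cliff δ n → Scalar) (w t : Word)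
                    .(s : ∣ w ∣ ≡ n) .(s′ : ∣ t ∣ ≡ n) → w ≡ t →
                    pair f (E-or-0 w s) ≈ pair f (E-or-0 t s′)
      E-or-0-cong f w _ s s′ refl = K.refl

      module _ {m n o r s t : ℕ} (f : Cliff δ t → Scalar)
               (u : Cliff δ m) (v : Cliff δ n) (w : Cliff δ o) where

        assocBasis : (i : Fin m) (j : Fin n) (k : Fin r)
                     .(p : suc r ≡ m + n) .(q : suc t ≡ r + o)
                     .(p′ : suc s ≡ n + o) .(q′ : suc t ≡ m + s) →
                     toℕ k ≡ toℕ i + toℕ j →
                     pair (λ x → pair f (composeBasis k q x w)) (composeBasis i p u v) ≈
                     pair (λ x → pair f (composeBasis i q′ u x)) (composeBasis j p′ v w)
        assocBasis i j k p q p′ q′ e = begin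
          pair (λ x → pair f (composeBasis k q x w)) (composeBasis i p u v)
            ≈⟨ pair-nested f _ uv W (size-uv p) (size p′ q′) (proj₁ ∘ cliffs)
                 (λ _ → E-or-0-cong f _ W (size-uvw p q) (size p′ q′) words) ⟩
          pair f (E-or-0 W (size p′ q′))
            ≈⟨ pair-nested f _ vw W (size-vw p′) (size p′ q′) (proj₂ ∘ cliffs)
                 (λ _ → K.refl) ⟨
          pair (λ x → pair f (composeBasis i q′ u x)) (composeBasis j p′ v w) ∎
          where
          uv = word u □[ suc (toℕ i) ] word v
          vw = word v □[ suc (toℕ j) ] word w
          W  = word u □[ suc (toℕ i) ] vw

          words : uv □[ suc (toℕ k) ] word w ≡ W
          words = □-assoc δ unimodal u v (word w) (relevant δ w)
                    (position δ u i) (position δ v j) e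

          cliffs : IsCliff δ W → IsCliff δ uv × IsCliff δ vw
          cliffs = cliff-assoc δ unimodal u v (word w) (relevant δ w)
                     (position δ u i) (position δ v j) e

          size-uv : .(suc r ≡ m + n) → ∣ uv ∣ ≡ r
          size-uv p = size-□ (word u) (suc (toℕ i)) (word v) (word-size u) (word-size v) p

          size-vw : .(suc s ≡ n + o) → ∣ vw ∣ ≡ s
          size-vw p = size-□ (word v) (suc (toℕ j)) (word w) (word-size v) (word-size w) p

          size-uvw : .(suc r ≡ m + n) → .(suc t ≡ r + o) → ∣ uv □[ suc (toℕ k) ] word w ∣ ≡ t
          size-uvw p q = size-□ uv (suc (toℕ k)) (word w) (size-uv p) (word-size w) q

          size : .(suc s ≡ n + o) → .(suc t ≡ m + s) → ∣ W ∣ ≡ t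
          size p q = size-□ (word u) (suc (toℕ i)) vw (word-size u) (size-vw p) q

        parallelBasis : (i j : Fin m) (k : Fin r) (l : Fin s)
                        .(p : suc r ≡ m + n) .(q : suc t ≡ r + o)
                        .(p′ : suc s ≡ m + o) .(q′ : suc t ≡ s + n) →
                        toℕ i < toℕ j → suc (toℕ k) ≡ toℕ j + n → toℕ l ≡ toℕ i →
                        pair (λ x → pair f (composeBasis k q x w)) (composeBasis i p u v) ≈
                        pair (λ x → pair f (composeBasis l q′ x v)) (composeBasis j p′ u w)
        parallelBasis i j k l p q p′ q′ i<j e e′ = begin
          pair (λ x → pair f (composeBasis k q x w)) (composeBasis i p u v)
            ≈⟨ pair-nested f _ uv W (size-uv p) (size p q) (proj₁ ∘ cliffs)
                 (λ _ → K.refl) ⟩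
          pair f (E-or-0 W (size p q))
            ≈⟨ pair-nested f _ uw W (size-uw p′) (size p q) (proj₂ ∘ cliffs)
                 (λ _ → E-or-0-cong f _ W (size-uwv p′ q′) (size p q)
                   (trans (cong (λ h → uw □[ suc h ] word v) e′) (sym words))) ⟨
          pair (λ x → pair f (composeBasis l q′ x v)) (composeBasis j p′ u w) ∎
          where
          uv = word u □[ suc (toℕ i) ] word v
          uw = word u □[ suc (toℕ j) ] word w
          W  = uv □[ suc (toℕ k) ] word w

          k≡ : toℕ k ≡ toℕ j + length (word v)
          k≡ = ℕₚ.suc-injective (trans e
                 (trans (cong (toℕ j +_) (sym (word-size v))) (ℕₚ.+-suc (toℕ j) _)))

          words : W ≡ uw □[ suc (toℕ i) ] word v
          words = □-parallel δ unimodal u (word v) (word w) (relevant δ v) (relevant δ w)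
                    (ℕₚ.<⇒≤ i<j) (position δ u j) k≡

          cliffs : IsCliff δ W → IsCliff δ uv × IsCliff δ uw
          cliffs = cliff-parallel δ unimodal u (word v) (word w) (relevant δ v) (relevant δ w)
                     (ℕₚ.<⇒≤ i<j) (position δ u j) k≡

          size-uv : .(suc r ≡ m + n) → ∣ uv ∣ ≡ r
          size-uv p = size-□ (word u) (suc (toℕ i)) (word v) (word-size u) (word-size v) p

          size-uw : .(suc s ≡ m + o) → ∣ uw ∣ ≡ s
          size-uw p = size-□ (word u) (suc (toℕ j)) (word w) (word-size u) (word-size w) p

          size-uwv : .(suc s ≡ m + o) → .(suc t ≡ s + n) → ∣ uw □[ suc (toℕ l) ] word v ∣ ≡ t
          size-uwv p q = size-□ uw (suc (toℕ l)) (word v) (size-uw p) (word-size v) q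

          size : .(suc r ≡ m + n) → .(suc t ≡ r + o) → ∣ W ∣ ≡ t
          size p q = size-□ uv (suc (toℕ k)) (word w) (size-uv p) (word-size w) q

      pair-compose : ∀ {m n r} (f : Cliff δ r → Scalar) (x : Element m) i (y : Element n)
                     .(p : suc r ≡ m + n) →
                     pair f (compose x i y p) ≈
                     pair (λ u → pair (λ v → pair f (composeBasis i p u v)) y) x
      pair-compose f x i y p = pair-bilinear (composeBasis i p) f x y

      compose-cong : ∀ {m n r} {x x′ : Element m} {i} {y y′ : Element n}
                     .{p : suc r ≡ m + n} →
                     x ≃ x′ → y ≃ y′ → compose x i y p ≃ compose x′ i y′ p
      compose-cong {x = x} {x′} {i} {y} {y′} {p} e e′ =
        ext λ f → begin
          pair f (compose x i y p)
            ≈⟨ pair-compose f x i y p ⟩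
          pair (λ u → pair (λ v → pair f (composeBasis i p u v)) y) x
            ≈⟨ pair-cong (λ u → ≃⇒pair≈ _≟ᶜ_ e′ _) x ⟩
          pair (λ u → pair (λ v → pair f (composeBasis i p u v)) y′) x
            ≈⟨ ≃⇒pair≈ _≟ᶜ_ e _ ⟩
          pair (λ u → pair (λ v → pair f (composeBasis i p u v)) y′) x′
            ≈⟨ pair-compose f x′ i y′ p ⟨
          pair f (compose x′ i y′ p) ∎

      compose-+ˡ : ∀ {m n r} {x x′ : Element m} {i} {y : Element n} .{p : suc r ≡ m + n} →
                   compose (x ++ x′) i y p ≃ compose x i y p ++ compose x′ i y p
      compose-+ˡ {x = x} {x′} {i} {y} {p} =
        ext λ f → begin
          pair f (compose (x ++ x′) i y p)
            ≈⟨ pair-compose f (x ++ x′) i y p ⟩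
          pair _ (x ++ x′)
            ≈⟨ pair-++ _ x x′ ⟩
          pair _ x K.+ pair _ x′
            ≈⟨ K.+-cong (pair-compose f x i y p) (pair-compose f x′ i y p) ⟨
          pair f (compose x i y p) K.+ pair f (compose x′ i y p)
            ≈⟨ pair-++ f (compose x i y p) _ ⟨
          pair f (compose x i y p ++ compose x′ i y p) ∎

      compose-+ʳ : ∀ {m n r} {x : Element m} {i} {y y′ : Element n} .{p : suc r ≡ m + n} →
                   compose x i (y ++ y′) p ≃ compose x i y p ++ compose x i y′ p
      compose-+ʳ {x = x} {i} {y} {y′} {p} =
        ext λ f → begin
          pair f (compose x i (y ++ y′) p)
            ≈⟨ pair-compose f x i (y ++ y′) p ⟩
          pair _ x
            ≈⟨ pair-cong (λ u → pair-++ _ y y′) x ⟩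
          pair (λ u → _ K.+ _) x
            ≈⟨ pair-+ _ _ x ⟩
          pair _ x K.+ pair _ x
            ≈⟨ K.+-cong (pair-compose f x i y p) (pair-compose f x i y′ p) ⟨
          pair f (compose x i y p) K.+ pair f (compose x i y′ p)
            ≈⟨ pair-++ f (compose x i y p) _ ⟨
          pair f (compose x i y p ++ compose x i y′ p) ∎

      compose-*ˡ : ∀ {m n r} {k} {x : Element m} {i} {y : Element n} .{p : suc r ≡ m + n} →
                   compose (scale k x) i y p ≃ scale k (compose x i y p)
      compose-*ˡ {k = k} {x} {i} {y} {p} =
        ext λ f → begin
          pair f (compose (scale k x) i y p)  ≈⟨ pair-compose f (scale k x) i y p ⟩
          pair _ (scale k x)                  ≈⟨ pair-scale _ k x ⟩
          k ⋆ pair _ x                        ≈⟨ K.*-congˡ (pair-compose f x i y p) ⟨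
          k ⋆ pair f (compose x i y p)        ≈⟨ pair-scale f k (compose x i y p) ⟨
          pair f (scale k (compose x i y p))  ∎

      compose-*ʳ : ∀ {m n r} {k} {x : Element m} {i} {y : Element n} .{p : suc r ≡ m + n} →
                   compose x i (scale k y) p ≃ scale k (compose x i y p)
      compose-*ʳ {k = k} {x} {i} {y} {p} =
        ext λ f → begin
          pair f (compose x i (scale k y) p)  ≈⟨ pair-compose f x i (scale k y) p ⟩
          pair _ x                            ≈⟨ pair-cong (λ u → pair-scale _ k y) x ⟩
          pair (λ u → k ⋆ _) x                ≈⟨ pair-* k _ x ⟩
          k ⋆ pair _ x                        ≈⟨ K.*-congˡ (pair-compose f x i y p) ⟨
          k ⋆ pair f (compose x i y p)        ≈⟨ pair-scale f k (compose x i y p) ⟨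
          pair f (scale k (compose x i y p))  ∎

      compose-identityˡ : ∀ {n} {x : Element n} → compose (E ε) zero x refl ≃ x
      compose-identityˡ {x = x} = ext λ f → begin
        pair f (compose (E ε) zero x refl)
          ≈⟨ pair-compose f (E ε) zero x refl ⟩
        pair (λ u → pair (λ v → pair f (composeBasis zero refl u v)) x) (E ε)
          ≈⟨ pair-E (λ u → pair (λ v → pair f (composeBasis zero refl u v)) x) ε ⟩
        pair (λ v → pair f (composeBasis zero refl ε v)) x
          ≈⟨ pair-cong (λ v → pair-cliff f v _ (++-identityʳ (word v))) x ⟩
        pair f x ∎

      compose-identityʳ : ∀ {n} {x : Element n} {i} .{p : suc n ≡ n + 1} →
                          compose x i (E ε) p ≃ x
      compose-identityʳ {x = x} {i} {p} = ext λ f → begin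
        pair f (compose x i (E ε) p)
          ≈⟨ pair-compose f x i (E ε) p ⟩
        pair (λ u → pair (λ v → pair f (composeBasis i p u v)) (E ε)) x
          ≈⟨ pair-cong (λ u → K.trans (pair-E (λ v → pair f (composeBasis i p u v)) ε)
               (pair-cliff f u _ (take++drop≡id (toℕ i) (word u)))) x ⟩
        pair f x ∎

      compose-assoc : ∀ {m n o r s t} {x : Element m} {y : Element n} {z : Element o}
                      {i : Fin m} {j : Fin n} {k : Fin r}
                      .{p : suc r ≡ m + n} .{q : suc t ≡ r + o}
                      .{p′ : suc s ≡ n + o} .{q′ : suc t ≡ m + s} →
                      toℕ k ≡ toℕ i + toℕ j →
                      compose (compose x i y p) k z q ≃ compose x i (compose y j z p′) q′
      compose-assoc {x = x} {y} {z} {i} {j} {k} {p} {q} {p′} {q′} e =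
        ext λ f → begin
          pair f (compose (compose x i y p) k z q)
            ≈⟨ pair-compose f (compose x i y p) k z q ⟩
          pair _ (compose x i y p)
            ≈⟨ pair-compose _ x i y p ⟩
          pair (λ u → pair (λ v → pair (λ a → pair (λ w → pair f (composeBasis k q a w)) z)
                                       (composeBasis i p u v)) y) x
            ≈⟨ pair-cong (λ u → pair-cong (λ v → pair-swap _ (composeBasis i p u v) z) y) x ⟩
          pair (λ u → pair (λ v → pair (λ w → pair (λ a → pair f (composeBasis k q a w))
                                                  (composeBasis i p u v)) z) y) x
            ≈⟨ pair-cong (λ u → pair-cong (λ v → pair-cong (λ w →
                 assocBasis f u v w i j k p q p′ q′ e) z) y) x ⟩
          pair (λ u → pair (λ v → pair (λ w → pair (λ a → pair f (composeBasis i q′ u a))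
                                                  (composeBasis j p′ v w)) z) y) x
            ≈⟨ pair-cong (λ u → pair-compose _ y j z p′) x ⟨
          pair (λ u → pair (λ a → pair f (composeBasis i q′ u a)) (compose y j z p′)) x
            ≈⟨ pair-compose f x i (compose y j z p′) q′ ⟨
          pair f (compose x i (compose y j z p′) q′) ∎

      compose-parallel : ∀ {m n o r s t} {x : Element m} {y : Element n} {z : Element o}
                         {i j : Fin m} {k : Fin r} {l : Fin s}
                         .{p : suc r ≡ m + n} .{q : suc t ≡ r + o}
                         .{p′ : suc s ≡ m + o} .{q′ : suc t ≡ s + n} →
                         toℕ i < toℕ j → suc (toℕ k) ≡ toℕ j + n → toℕ l ≡ toℕ i →
                         compose (compose x i y p) k z q ≃ compose (compose x j z p′) l y q′
      compose-parallel {x = x} {y} {z} {i} {j} {k} {l} {p} {q} {p′} {q′} i<j e e′ =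
        ext λ f → begin
          pair f (compose (compose x i y p) k z q)
            ≈⟨ pair-compose f (compose x i y p) k z q ⟩
          pair _ (compose x i y p)
            ≈⟨ pair-compose _ x i y p ⟩
          pair (λ u → pair (λ v → pair (λ a → pair (λ w → pair f (composeBasis k q a w)) z)
                                       (composeBasis i p u v)) y) x
            ≈⟨ pair-cong (λ u → pair-cong (λ v → pair-swap _ (composeBasis i p u v) z) y) x ⟩
          pair (λ u → pair (λ v → pair (λ w → pair (λ a → pair f (composeBasis k q a w))
                                                  (composeBasis i p u v)) z) y) x
            ≈⟨ pair-cong (λ u → pair-cong (λ v → pair-cong (λ w →
                 parallelBasis f u v w i j k l p q p′ q′ i<j e e′) z) y) x ⟩
          pair (λ u → pair (λ v → pair (λ w → pair (λ a → pair f (composeBasis l q′ a v))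
                                                  (composeBasis j p′ u w)) z) y) x
            ≈⟨ pair-cong (λ u → pair-swap _ y z) x ⟩
          pair (λ u → pair (λ w → pair (λ v → pair (λ a → pair f (composeBasis l q′ a v))
                                                  (composeBasis j p′ u w)) y) z) x
            ≈⟨ pair-cong (λ u → pair-cong (λ w → pair-swap _ (composeBasis j p′ u w) y) z) x ⟨
          pair (λ u → pair (λ w → pair (λ a → pair (λ v → pair f (composeBasis l q′ a v)) y)
                                       (composeBasis j p′ u w)) z) x
            ≈⟨ pair-compose _ x j z p′ ⟨
          pair _ (compose x j z p′)
            ≈⟨ pair-compose f (compose x j z p′) l y q′ ⟨
          pair f (compose (compose x j z p′) l y q′) ∎

    Cl : NSOperad K c ℓ
    Cl = record
      { space = λ n → freeModule (_≟ᶜ_ {δ} {n})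
      ; _∘[_]_by_ = compose
      ; unit = E ε
      ; ∘-cong = λ {_} {_} {_} {x} {x′} {i} {y} {y′} {p} →
          compose-cong {x = x} {x′} {i} {y} {y′} {p}
      ; ∘-+ˡ = λ {_} {_} {_} {x} {x′} {i} {y} {p} → compose-+ˡ {x = x} {x′} {i} {y} {p}
      ; ∘-+ʳ = λ {_} {_} {_} {x} {i} {y} {y′} {p} → compose-+ʳ {x = x} {i} {y} {y′} {p}
      ; ∘-*ˡ = λ {_} {_} {_} {k} {x} {i} {y} {p} → compose-*ˡ {k = k} {x} {i} {y} {p}
      ; ∘-*ʳ = λ {_} {_} {_} {k} {x} {i} {y} {p} → compose-*ʳ {k = k} {x} {i} {y} {p}
      ; ∘-identityˡ = compose-identityˡ
      ; ∘-identityʳ = λ {_} {x} {i} {p} → compose-identityʳ {x = x} {i} {p}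
      ; ∘-assoc = λ {_} {_} {_} {_} {_} {_} {x} {y} {z} {i} {j} {k} {p} {q} {p′} {q′} →
          compose-assoc {x = x} {y} {z} {i} {j} {k} {p} {q} {p′} {q′}
      ; ∘-parallel = λ {_} {_} {_} {_} {_} {_} {x} {y} {z} {i} {j} {k} {l} {p} {q} {p′} {q′} →
          compose-parallel {x = x} {y} {z} {i} {j} {k} {l} {p} {q} {p′} {q′}
      }

    canonicalMorphism : Morphism (free K (Generator δ)) Cl
    canonicalMorphism = lift K (Generator δ) Cl (E ∘ cliff)

    NontrivialRelations : ∀ {n} → NSOperad.Carrier (free K (Generator δ)) n → Set ℓ
    NontrivialRelations = Kernel canonicalMorphism

{-# OPTIONS --safe #-}
-- Sending a term to the matrix of coefficients
--
--   ⎛ c₀  f   q ⎞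
--   ⎜ 0   c₀  h ⎟
--   ⎝ 0   0   c₀⎠
--
-- where c₀ is the coefficient of the unit, f and h are linear forms on the generators, and q is
-- the induced form on composites of two generators, turns every partial composition into a matrix
-- product.  Relations have c₀ = f = h = 0 because primes are indecomposable, so an element of an
-- ideal generated by relations of arity at most N has q = 0 in arity above N.  On the other hand
-- each prime u gives the quadratic relation E_u ∘ E_0 − E_0 ∘ E_u = 0 expressing u □ 0 = 0 □ u,
-- with q = 1 if f detects u and h detects 0.  Not being 1-dominated makes δ exceed δ(1) from some
-- position a + 2 on, and then the words 0 ⋯ 0 (δ(1)+1) ⋯ (δ(1)+1) with a + 1 zeros are prime
-- cliffs of unbounded length.
module Submission where

open import Defs
open import Algebra.Apartness.Bundles using (HeytingField)
open import Algebra.Bundles using (CommutativeRing)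
import Algebra.Properties.Ring as RingProperties
import Algebra.Solver.Ring.NaturalCoefficients.Default as NatSolver
open import Data.Bool.Base using (if_then_else_)
open import Data.Empty using (⊥; ⊥-elim-irr)
open import Data.Fin.Base using (Fin; zero; suc; toℕ; fromℕ)
open import Data.Fin.Properties using (toℕ-fromℕ)
open import Data.List.Base
  using (List; []; _∷_; _++_; filter; length; lookup; replicate; take; drop)
open import Data.List.Membership.Propositional using (_∈_)
open import Data.List.Properties
  using (≡-dec; ++-identityʳ; filter-++; filter-accept; filter-all; filter-none; length-++;
         length-++-≤ʳ; length-replicate; take++drop≡id; take-[]; drop-[]; take-all; drop-all)
import Data.List.Relation.Unary.All.Properties as All
open import Data.List.Relation.Unary.Any using (Any; any?; here; there)
import Data.List.Relation.Unary.Any.Properties as Any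
open import Data.Nat.Base using (ℕ; zero; suc; _+_; _∸_; _≤_; _<_; z≤n; s≤s; _⊔_)
import Data.Nat.Properties as ℕₚ
open import Data.Product.Base using (Σ; ∃-syntax; _×_; _,_; proj₁; proj₂)
open import Data.Sum.Base using (_⊎_; inj₁; inj₂; [_,_]′)
open import Function.Base using (_∘_)
open import Function.Bundles using (module Equivalence)
open import Relation.Binary.PropositionalEquality
  using (_≡_; _≢_; refl; sym; trans; cong; cong₂; subst; module ≡-Reasoning)
import Relation.Binary.Reasoning.Setoid as SetoidReasoning
open import Relation.Nullary.Decidable.Core using (Dec; yes; no; does; recompute)
open import Relation.Nullary.Negation.Core using (¬_; contradiction)
open import Relation.Unary using (Decidable)

-- Unit, linear and quadratic coefficients on the free operad.

module Coefficients {c ℓ} (K : CommutativeRing c ℓ) where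
  open CommutativeRing K
    using (_≈_; 0#; 1#; +-cong; *-cong; *-congˡ; *-congʳ; +-congˡ; +-congʳ)
    renaming (Carrier to Scalar; _+_ to _⊹_; _*_ to _⋆_)
  private
    module K = CommutativeRing K
    open NatSolver K.commutativeSemiring using (solve; con; _:+_; _:*_; _:=_)

    x*yz≈y*xz : ∀ x y z → x ⋆ (y ⋆ z) ≈ y ⋆ (x ⋆ z)
    x*yz≈y*xz = solve 3 (λ x y z → x :* (y :* z) := y :* (x :* z)) K.refl

    xy*z≈xz*y : ∀ x y z → (x ⋆ y) ⋆ z ≈ (x ⋆ z) ⋆ y
    xy*z≈xz*y = solve 3 (λ x y z → (x :* y) :* z := (x :* z) :* y) K.refl

    -- The `leibniz` identities are the axioms of operads read in the entry `f` of the matrix, and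
    -- the `leibniz₂` identities below are the same axioms read in the corner. Here `a`, `b`, `d`
    -- stand for unit coefficients, and `x`, `y`, `z` for the entry in question.
    leibniz-+ˡ : ∀ x x′ y a a′ b →
      (x ⊹ x′) ⋆ b ⊹ (a ⊹ a′) ⋆ y ≈ (x ⋆ b ⊹ a ⋆ y) ⊹ (x′ ⋆ b ⊹ a′ ⋆ y)
    leibniz-+ˡ = solve 6 (λ x x′ y a a′ b →
      (x :+ x′) :* b :+ (a :+ a′) :* y := (x :* b :+ a :* y) :+ (x′ :* b :+ a′ :* y)) K.refl

    leibniz-+ʳ : ∀ x y y′ a b b′ →
      x ⋆ (b ⊹ b′) ⊹ a ⋆ (y ⊹ y′) ≈ (x ⋆ b ⊹ a ⋆ y) ⊹ (x ⋆ b′ ⊹ a ⋆ y′)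
    leibniz-+ʳ = solve 6 (λ x y y′ a b b′ →
      x :* (b :+ b′) :+ a :* (y :+ y′) := (x :* b :+ a :* y) :+ (x :* b′ :+ a :* y′)) K.refl

    leibniz-*ˡ : ∀ k x y a b → (k ⋆ x) ⋆ b ⊹ (k ⋆ a) ⋆ y ≈ k ⋆ (x ⋆ b ⊹ a ⋆ y)
    leibniz-*ˡ = solve 5 (λ k x y a b →
      (k :* x) :* b :+ (k :* a) :* y := k :* (x :* b :+ a :* y)) K.refl

    leibniz-*ʳ : ∀ k x y a b → x ⋆ (k ⋆ b) ⊹ a ⋆ (k ⋆ y) ≈ k ⋆ (x ⋆ b ⊹ a ⋆ y)
    leibniz-*ʳ = solve 5 (λ k x y a b →
      x :* (k :* b) :+ a :* (k :* y) := k :* (x :* b :+ a :* y)) K.refl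

    leibniz-identityˡ : ∀ x a → 0# ⋆ a ⊹ 1# ⋆ x ≈ x
    leibniz-identityˡ = solve 2 (λ x a → con 0 :* a :+ con 1 :* x := x) K.refl

    leibniz-identityʳ : ∀ x a → x ⋆ 1# ⊹ a ⋆ 0# ≈ x
    leibniz-identityʳ = solve 2 (λ x a → x :* con 1 :+ a :* con 0 := x) K.refl

    leibniz-assoc : ∀ x y z a b d →
      (x ⋆ b ⊹ a ⋆ y) ⋆ d ⊹ (a ⋆ b) ⋆ z ≈ x ⋆ (b ⋆ d) ⊹ a ⋆ (y ⋆ d ⊹ b ⋆ z)
    leibniz-assoc = solve 6 (λ x y z a b d →
      (x :* b :+ a :* y) :* d :+ (a :* b) :* z :=
      x :* (b :* d) :+ a :* (y :* d :+ b :* z)) K.refl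

    leibniz-parallel : ∀ x y z a b d →
      (x ⋆ b ⊹ a ⋆ y) ⋆ d ⊹ (a ⋆ b) ⋆ z ≈ (x ⋆ d ⊹ a ⋆ z) ⋆ b ⊹ (a ⋆ d) ⋆ y
    leibniz-parallel = solve 6 (λ x y z a b d →
      (x :* b :+ a :* y) :* d :+ (a :* b) :* z :=
      (x :* d :+ a :* z) :* b :+ (a :* d) :* y) K.refl

    leibniz₂-+ˡ : ∀ x x′ y a a′ b f f′ h →
      (x ⊹ x′) ⋆ b ⊹ (a ⊹ a′) ⋆ y ⊹ (f ⊹ f′) ⋆ h ≈
      (x ⋆ b ⊹ a ⋆ y ⊹ f ⋆ h) ⊹ (x′ ⋆ b ⊹ a′ ⋆ y ⊹ f′ ⋆ h)
    leibniz₂-+ˡ = solve 9 (λ x x′ y a a′ b f f′ h →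
      (x :+ x′) :* b :+ (a :+ a′) :* y :+ (f :+ f′) :* h :=
      (x :* b :+ a :* y :+ f :* h) :+ (x′ :* b :+ a′ :* y :+ f′ :* h)) K.refl

    leibniz₂-+ʳ : ∀ x y y′ a b b′ f h h′ →
      x ⋆ (b ⊹ b′) ⊹ a ⋆ (y ⊹ y′) ⊹ f ⋆ (h ⊹ h′) ≈
      (x ⋆ b ⊹ a ⋆ y ⊹ f ⋆ h) ⊹ (x ⋆ b′ ⊹ a ⋆ y′ ⊹ f ⋆ h′)
    leibniz₂-+ʳ = solve 9 (λ x y y′ a b b′ f h h′ →
      x :* (b :+ b′) :+ a :* (y :+ y′) :+ f :* (h :+ h′) :=
      (x :* b :+ a :* y :+ f :* h) :+ (x :* b′ :+ a :* y′ :+ f :* h′)) K.refl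

    leibniz₂-*ˡ : ∀ k x y a b f h →
      (k ⋆ x) ⋆ b ⊹ (k ⋆ a) ⋆ y ⊹ (k ⋆ f) ⋆ h ≈ k ⋆ (x ⋆ b ⊹ a ⋆ y ⊹ f ⋆ h)
    leibniz₂-*ˡ = solve 7 (λ k x y a b f h →
      (k :* x) :* b :+ (k :* a) :* y :+ (k :* f) :* h :=
      k :* (x :* b :+ a :* y :+ f :* h)) K.refl

    leibniz₂-*ʳ : ∀ k x y a b f h →
      x ⋆ (k ⋆ b) ⊹ a ⋆ (k ⋆ y) ⊹ f ⋆ (k ⋆ h) ≈ k ⋆ (x ⋆ b ⊹ a ⋆ y ⊹ f ⋆ h)
    leibniz₂-*ʳ = solve 7 (λ k x y a b f h →
      x :* (k :* b) :+ a :* (k :* y) :+ f :* (k :* h) :=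
      k :* (x :* b :+ a :* y :+ f :* h)) K.refl

    leibniz₂-identityˡ : ∀ x a h → 0# ⋆ a ⊹ 1# ⋆ x ⊹ 0# ⋆ h ≈ x
    leibniz₂-identityˡ = solve 3 (λ x a h → con 0 :* a :+ con 1 :* x :+ con 0 :* h := x) K.refl

    leibniz₂-identityʳ : ∀ x a f → x ⋆ 1# ⊹ a ⋆ 0# ⊹ f ⋆ 0# ≈ x
    leibniz₂-identityʳ = solve 3 (λ x a f → x :* con 1 :+ a :* con 0 :+ f :* con 0 := x) K.refl

    leibniz₂-assoc : ∀ x y z a b d fx fy hy hz →
      (x ⋆ b ⊹ a ⋆ y ⊹ fx ⋆ hy) ⋆ d ⊹ (a ⋆ b) ⋆ z ⊹ (fx ⋆ b ⊹ a ⋆ fy) ⋆ hz ≈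
      x ⋆ (b ⋆ d) ⊹ a ⋆ (y ⋆ d ⊹ b ⋆ z ⊹ fy ⋆ hz) ⊹ fx ⋆ (hy ⋆ d ⊹ b ⋆ hz)
    leibniz₂-assoc = solve 10 (λ x y z a b d fx fy hy hz →
      (x :* b :+ a :* y :+ fx :* hy) :* d :+ (a :* b) :* z :+ (fx :* b :+ a :* fy) :* hz :=
      x :* (b :* d) :+ a :* (y :* d :+ b :* z :+ fy :* hz) :+ fx :* (hy :* d :+ b :* hz)) K.refl

    -- The two products of matrices with y and z exchanged differ in the corner by a multiple of a,
    -- the coefficient of the unit in x, which vanishes as x has at least two inputs.
    leibniz₂-parallel : ∀ x y z a b d fx fy hy fz hz →
      ((x ⋆ b ⊹ a ⋆ y ⊹ fx ⋆ hy) ⋆ d ⊹ (a ⋆ b) ⋆ z ⊹ (fx ⋆ b ⊹ a ⋆ fy) ⋆ hz) ⊹ a ⋆ (fz ⋆ hy) ≈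
      ((x ⋆ d ⊹ a ⋆ z ⊹ fx ⋆ hz) ⋆ b ⊹ (a ⋆ d) ⋆ y ⊹ (fx ⋆ d ⊹ a ⋆ fz) ⋆ hy) ⊹ a ⋆ (fy ⋆ hz)
    leibniz₂-parallel = solve 11 (λ x y z a b d fx fy hy fz hz →
      ((x :* b :+ a :* y :+ fx :* hy) :* d :+ (a :* b) :* z :+ (fx :* b :+ a :* fy) :* hz)
        :+ a :* (fz :* hy) :=
      ((x :* d :+ a :* z :+ fx :* hz) :* b :+ (a :* d) :* y :+ (fx :* d :+ a :* fz) :* hy)
        :+ a :* (fy :* hz)) K.refl

    cancel-zeros : ∀ {x y a} t s → a ≈ 0# → x ⊹ a ⋆ t ≈ y ⊹ a ⋆ s → x ≈ y
    cancel-zeros t s a≈0 e =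
      K.trans (drop-zero t) (K.trans e (K.sym (drop-zero s)))
      where
      drop-zero : ∀ {x} t → x ≈ x ⊹ _ ⋆ t
      drop-zero t =
        K.sym (K.trans (+-congˡ (K.trans (*-congʳ a≈0) (K.zeroˡ t))) (K.+-identityʳ _))

  module _ {G : ℕ → Set} where
    open FreeOperad K G

    unitCoeff : ∀ {n} → Term n → Scalar
    unitCoeff (gen g)           = 0#
    unitCoeff unit              = 1#
    unitCoeff (x ∘[ i ] y by p) = unitCoeff x ⋆ unitCoeff y
    unitCoeff 𝟘                 = 0#
    unitCoeff (x ⊕ y)           = unitCoeff x ⊹ unitCoeff y
    unitCoeff (k ⊛ x)           = k ⋆ unitCoeff x

    linearCoeff : (∀ {n} → G n → Scalar) → ∀ {n} → Term n → Scalar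
    linearCoeff f (gen g)           = f g
    linearCoeff f unit              = 0#
    linearCoeff f (x ∘[ i ] y by p) =
      linearCoeff f x ⋆ unitCoeff y ⊹ unitCoeff x ⋆ linearCoeff f y
    linearCoeff f 𝟘                 = 0#
    linearCoeff f (x ⊕ y)           = linearCoeff f x ⊹ linearCoeff f y
    linearCoeff f (k ⊛ x)           = k ⋆ linearCoeff f x

    -- On a composite of two generators `f` reads the outer one and `h` the inner one. This
    -- asymmetry is what later separates the two sides of a commutation relation.
    quadraticCoeff : (f h : ∀ {n} → G n → Scalar) → ∀ {n} → Term n → Scalar
    quadraticCoeff f h (gen g)           = 0#
    quadraticCoeff f h unit              = 0#
    quadraticCoeff f h (x ∘[ i ] y by p) =
      quadraticCoeff f h x ⋆ unitCoeff y ⊹ unitCoeff x ⋆ quadraticCoeff f h y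
        ⊹ linearCoeff f x ⋆ linearCoeff h y
    quadraticCoeff f h 𝟘                 = 0#
    quadraticCoeff f h (x ⊕ y)           = quadraticCoeff f h x ⊹ quadraticCoeff f h y
    quadraticCoeff f h (k ⊛ x)           = k ⋆ quadraticCoeff f h x

    -- If both factors of a composite have arity 1, so has the composite; hence in any other arity
    -- some factor has arity different from 1 and contributes a zero. The condition is not `2 ≤ n`
    -- because inner factors of arity 0 also occur.
    unitCoeff-arity : ∀ {n} → n ≢ 1 → (x : Term n) → unitCoeff x ≈ 0#
    unitCoeff-arity n≢1 (gen g) = K.refl
    unitCoeff-arity n≢1 unit    = contradiction refl n≢1
    unitCoeff-arity {r} r≢1 (_∘[_]_by_ {m} {n} x i y p) with m ℕₚ.≟ 1
    ... | no m≢1 = K.trans (*-congʳ (unitCoeff-arity m≢1 x)) (K.zeroˡ _)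
    ... | yes refl with n ℕₚ.≟ 1
    ...   | no n≢1 = K.trans (*-congˡ (unitCoeff-arity n≢1 y)) (K.zeroʳ _)
    ...   | yes refl = contradiction (ℕₚ.suc-injective (recompute (_ ℕₚ.≟ _) p)) r≢1
    unitCoeff-arity n≢1 𝟘       = K.refl
    unitCoeff-arity n≢1 (x ⊕ y) =
      K.trans (+-cong (unitCoeff-arity n≢1 x) (unitCoeff-arity n≢1 y)) (K.+-identityˡ _)
    unitCoeff-arity n≢1 (k ⊛ x) = K.trans (*-congˡ (unitCoeff-arity n≢1 x)) (K.zeroʳ _)

    private
      arity≢1 : ∀ {m} {i j : Fin m} → toℕ i < toℕ j → m ≢ 1
      arity≢1 {i = zero} {zero} () refl

    unitCoeff-cong : ∀ {n} {x y : Term n} → x ≋ y → unitCoeff x ≈ unitCoeff y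
    unitCoeff-cong ≋-refl         = K.refl
    unitCoeff-cong (≋-sym e)      = K.sym (unitCoeff-cong e)
    unitCoeff-cong (≋-trans e e′) = K.trans (unitCoeff-cong e) (unitCoeff-cong e′)
    unitCoeff-cong (⊕-cong e e′)  = +-cong (unitCoeff-cong e) (unitCoeff-cong e′)
    unitCoeff-cong (⊛-cong e e′)  = *-cong e (unitCoeff-cong e′)
    unitCoeff-cong ⊕-assoc        = K.+-assoc _ _ _
    unitCoeff-cong ⊕-comm         = K.+-comm _ _
    unitCoeff-cong ⊕-identityˡ    = K.+-identityˡ _
    unitCoeff-cong ⊛-zeroˡ        = K.zeroˡ _
    unitCoeff-cong ⊛-identityˡ    = K.*-identityˡ _
    unitCoeff-cong ⊛-assoc        = K.*-assoc _ _ _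
    unitCoeff-cong ⊛-distribʳ     = K.distribʳ _ _ _
    unitCoeff-cong ⊛-distribˡ     = K.distribˡ _ _ _
    unitCoeff-cong (∘-cong e e′)  = *-cong (unitCoeff-cong e) (unitCoeff-cong e′)
    unitCoeff-cong ∘-⊕ˡ           = K.distribʳ _ _ _
    unitCoeff-cong ∘-⊕ʳ           = K.distribˡ _ _ _
    unitCoeff-cong ∘-⊛ˡ           = K.*-assoc _ _ _
    unitCoeff-cong ∘-⊛ʳ           = x*yz≈y*xz _ _ _
    unitCoeff-cong ∘-identityˡ    = K.*-identityˡ _
    unitCoeff-cong ∘-identityʳ    = K.*-identityʳ _
    unitCoeff-cong (∘-assoc _)    = K.*-assoc _ _ _
    unitCoeff-cong (∘-parallel {x = x} {y} {z} _ _ _) =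
      xy*z≈xz*y (unitCoeff x) (unitCoeff y) (unitCoeff z)

    module _ (f : ∀ {n} → G n → Scalar) where
      linearCoeff-cong : ∀ {n} {x y : Term n} → x ≋ y → linearCoeff f x ≈ linearCoeff f y
      linearCoeff-cong ≋-refl         = K.refl
      linearCoeff-cong (≋-sym e)      = K.sym (linearCoeff-cong e)
      linearCoeff-cong (≋-trans e e′) = K.trans (linearCoeff-cong e) (linearCoeff-cong e′)
      linearCoeff-cong (⊕-cong e e′)  = +-cong (linearCoeff-cong e) (linearCoeff-cong e′)
      linearCoeff-cong (⊛-cong e e′)  = *-cong e (linearCoeff-cong e′)
      linearCoeff-cong ⊕-assoc        = K.+-assoc _ _ _
      linearCoeff-cong ⊕-comm         = K.+-comm _ _
      linearCoeff-cong ⊕-identityˡ    = K.+-identityˡ _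
      linearCoeff-cong ⊛-zeroˡ        = K.zeroˡ _
      linearCoeff-cong ⊛-identityˡ    = K.*-identityˡ _
      linearCoeff-cong ⊛-assoc        = K.*-assoc _ _ _
      linearCoeff-cong ⊛-distribʳ     = K.distribʳ _ _ _
      linearCoeff-cong ⊛-distribˡ     = K.distribˡ _ _ _
      linearCoeff-cong (∘-cong e e′)  =
        +-cong (*-cong (linearCoeff-cong e) (unitCoeff-cong e′))
               (*-cong (unitCoeff-cong e) (linearCoeff-cong e′))
      linearCoeff-cong ∘-⊕ˡ           = leibniz-+ˡ _ _ _ _ _ _
      linearCoeff-cong ∘-⊕ʳ           = leibniz-+ʳ _ _ _ _ _ _
      linearCoeff-cong ∘-⊛ˡ           = leibniz-*ˡ _ _ _ _ _
      linearCoeff-cong ∘-⊛ʳ           = leibniz-*ʳ _ _ _ _ _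
      linearCoeff-cong ∘-identityˡ    = leibniz-identityˡ _ _
      linearCoeff-cong ∘-identityʳ    = leibniz-identityʳ _ _
      linearCoeff-cong (∘-assoc _)    = leibniz-assoc _ _ _ _ _ _
      -- Upper triangular 2 × 2 matrices with constant diagonal commute, so no argument on arities
      -- enters here, in contrast to the quadratic case.
      linearCoeff-cong (∘-parallel _ _ _) = leibniz-parallel _ _ _ _ _ _

    module _ (f h : ∀ {n} → G n → Scalar) where
      quadraticCoeff-cong : ∀ {n} {x y : Term n} → x ≋ y →
                            quadraticCoeff f h x ≈ quadraticCoeff f h y
      quadraticCoeff-cong ≋-refl         = K.refl
      quadraticCoeff-cong (≋-sym e)      = K.sym (quadraticCoeff-cong e)
      quadraticCoeff-cong (≋-trans e e′) = K.trans (quadraticCoeff-cong e) (quadraticCoeff-cong e′)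
      quadraticCoeff-cong (⊕-cong e e′)  = +-cong (quadraticCoeff-cong e) (quadraticCoeff-cong e′)
      quadraticCoeff-cong (⊛-cong e e′)  = *-cong e (quadraticCoeff-cong e′)
      quadraticCoeff-cong ⊕-assoc        = K.+-assoc _ _ _
      quadraticCoeff-cong ⊕-comm         = K.+-comm _ _
      quadraticCoeff-cong ⊕-identityˡ    = K.+-identityˡ _
      quadraticCoeff-cong ⊛-zeroˡ        = K.zeroˡ _
      quadraticCoeff-cong ⊛-identityˡ    = K.*-identityˡ _
      quadraticCoeff-cong ⊛-assoc        = K.*-assoc _ _ _
      quadraticCoeff-cong ⊛-distribʳ     = K.distribʳ _ _ _
      quadraticCoeff-cong ⊛-distribˡ     = K.distribˡ _ _ _
      quadraticCoeff-cong (∘-cong e e′)  =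
        +-cong (+-cong (*-cong (quadraticCoeff-cong e) (unitCoeff-cong e′))
                       (*-cong (unitCoeff-cong e) (quadraticCoeff-cong e′)))
               (*-cong (linearCoeff-cong f e) (linearCoeff-cong h e′))
      quadraticCoeff-cong ∘-⊕ˡ           = leibniz₂-+ˡ _ _ _ _ _ _ _ _ _
      quadraticCoeff-cong ∘-⊕ʳ           = leibniz₂-+ʳ _ _ _ _ _ _ _ _ _
      quadraticCoeff-cong ∘-⊛ˡ           = leibniz₂-*ˡ _ _ _ _ _ _ _
      quadraticCoeff-cong ∘-⊛ʳ           = leibniz₂-*ʳ _ _ _ _ _ _ _
      quadraticCoeff-cong ∘-identityˡ    = leibniz₂-identityˡ _ _ _
      quadraticCoeff-cong ∘-identityʳ    = leibniz₂-identityʳ _ _ _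
      quadraticCoeff-cong (∘-assoc _)    = leibniz₂-assoc _ _ _ _ _ _ _ _ _ _
      quadraticCoeff-cong (∘-parallel {x = x} {y} {z} i<j _ _) =
        cancel-zeros (linearCoeff f z ⋆ linearCoeff h y) (linearCoeff f y ⋆ linearCoeff h z)
          (unitCoeff-arity (arity≢1 i<j) x)
          (leibniz₂-parallel _ _ _ _ _ _ _ _ _ _ _)

-- Insertion of words, and a bound on arities.

□-ε : ∀ u i → u □[ i ] [] ≡ u
□-ε u i = take++drop≡id (i ∸ 1) u

ε-□ : ∀ i v → [] □[ i ] v ≡ v
ε-□ i v = trans (cong₂ (λ s t → s ++ v ++ t) (take-[] (i ∸ 1)) (drop-[] (i ∸ 1))) (++-identityʳ v)

□≡ε : ∀ u i v → u □[ i ] v ≡ [] → u ≡ [] × v ≡ []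
□≡ε u i v e = length≡0 u (ℕₚ.m+n≡0⇒m≡0 _ l) , length≡0 v (ℕₚ.m+n≡0⇒n≡0 (length u) l)
  where
  l : length u + length v ≡ 0
  l = trans (sym (length-□ u i v)) (cong length e)

  length≡0 : ∀ (w : Word) → length w ≡ 0 → w ≡ []
  length≡0 [] _ = refl

maxArity : ∀ {a} {A : ℕ → Set a} → List (Σ ℕ A) → ℕ
maxArity []            = 0
maxArity ((n , _) ∷ S) = n ⊔ maxArity S

∈⇒≤maxArity : ∀ {a} {A : ℕ → Set a} {S : List (Σ ℕ A)} {n x} → (n , x) ∈ S → n ≤ maxArity S
∈⇒≤maxArity (here refl)                   = ℕₚ.m≤m⊔n _ _
∈⇒≤maxArity {S = (m , _) ∷ _} (there x∈S) = ℕₚ.≤-trans (∈⇒≤maxArity x∈S) (ℕₚ.m≤n⊔m m _)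

-- Coefficients in the cliff operad, and ideals generated by relations.

module CliffCoefficients {c ℓ} (K : CommutativeRing c ℓ) (δ : RangeMap) (unimodal : Unimodal δ)
  where
  open CommutativeRing K
    using (_≈_; 0#; 1#; setoid; +-cong; *-cong; *-congˡ; *-congʳ; +-congˡ; +-congʳ)
    renaming (Carrier to Scalar; _+_ to _⊹_; _*_ to _⋆_)
  private module K = CommutativeRing K
  open FreeOperad K (Generator δ) using (Term; gen; unit; _∘[_]_by_; 𝟘; _⊕_; _⊛_)
  open FreeModule K
    using (pair; pair-cong; pair-++; pair-scale; pair-bilinear; pair-+; pair-*; ≃⇒pair≈)
  open CliffOperad K δ
  open Coefficients K
  open SetoidReasoning setoid

  [_≟_] : Word → Word → Scalar
  [ v ≟ w ] = if does (≡-dec ℕₚ._≟_ v w) then 1# else 0#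

  ≟-yes : ∀ {v w} → v ≡ w → [ v ≟ w ] ≈ 1#
  ≟-yes {v} {w} v≡w with ≡-dec ℕₚ._≟_ v w
  ... | yes _  = K.refl
  ... | no v≢w = contradiction v≡w v≢w

  ≟-no : ∀ {v w} → v ≢ w → [ v ≟ w ] ≈ 0#
  ≟-no {v} {w} v≢w with ≡-dec ℕₚ._≟_ v w
  ... | yes v≡w = contradiction v≡w v≢w
  ... | no _    = K.refl

  -- The form is defined in every arity, so that no arities have to be matched; it vanishes outside
  -- arity `∣ w ∣`.
  at : Word → ∀ {n} → Cliff δ n → Scalar
  at w v = [ Cliff.word v ≟ w ]

  pair-E : ∀ {n} (F : Cliff δ n → Scalar) v → pair F (E v) ≈ F v
  pair-E F v = K.trans (K.+-identityʳ _) (K.*-identityˡ _)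

  -- The truncation to zero is invisible to the form at a cliff `w`: a word that gets truncated is
  -- no cliff and so differs from `w`.
  pair-E-or-0 : ∀ {n} w → IsCliff δ w → ∀ v .(s : ∣ v ∣ ≡ n) → pair (at w) (E-or-0 v s) ≈ [ v ≟ w ]
  pair-E-or-0 w cliff-w v s with isCliff? δ v
  ... | yes p = pair-E (at w) (mkCliff v p s)
  ... | no ¬p = K.sym (≟-no {v} {w} λ { refl → ¬p cliff-w })

  pair-product : ∀ {A B : Set} (F : A → Scalar) (H : B → Scalar) x y →
                 pair (λ a → pair (λ b → F a ⋆ H b) y) x ≈ pair F x ⋆ pair H y
  pair-product F H x y = begin
    pair (λ a → pair (λ b → F a ⋆ H b) y) x  ≈⟨ pair-cong (λ a → pair-* (F a) H y) x ⟩
    pair (λ a → F a ⋆ pair H y) x            ≈⟨ pair-cong (λ a → K.*-comm _ _) x ⟩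
    pair (λ a → pair H y ⋆ F a) x            ≈⟨ pair-* (pair H y) F x ⟩
    pair H y ⋆ pair F x                      ≈⟨ K.*-comm _ _ ⟩
    pair F x ⋆ pair H y                      ∎

  -- Lengths add under insertion, so the result is empty exactly when both words are. This is the
  -- rule by which `unitCoeff` treats composites.
  ε-coefficient : ∀ {m n r} (i : Fin m) .(p : suc r ≡ m + n) (u : Cliff δ m) (v : Cliff δ n) →
                  pair (at []) (composeBasis i p u v) ≈ at [] u ⋆ at [] v
  ε-coefficient i p (mkCliff u _ s) (mkCliff v _ t) =
    K.trans (pair-E-or-0 [] (λ ()) (u □[ suc (toℕ i) ] v) (size-□ u (suc (toℕ i)) v s t p)) cases
    where
    cases : [ u □[ suc (toℕ i) ] v ≟ [] ] ≈ [ u ≟ [] ] ⋆ [ v ≟ [] ]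
    cases with ≡-dec ℕₚ._≟_ u [] | ≡-dec ℕₚ._≟_ v []
    ... | yes refl | yes refl =
      K.trans (≟-yes {w = []} (ε-□ (suc (toℕ i)) [])) (K.sym (K.*-identityˡ _))
    ... | no u≢ε   | _        =
      K.trans (≟-no {w = []} (u≢ε ∘ proj₁ ∘ □≡ε u (suc (toℕ i)) v)) (K.sym (K.zeroˡ _))
    ... | yes refl | no v≢ε   =
      K.trans (≟-no {w = []} (v≢ε ∘ proj₂ ∘ □≡ε [] (suc (toℕ i)) v)) (K.sym (K.zeroʳ _))

  -- Indecomposability leaves only the factorizations of `w` with an empty factor, and `w` being
  -- nonempty keeps these two apart. The result is the Leibniz rule by which `linearCoeff` treats
  -- composites.
  prime-coefficient : ∀ {w} → IsPrime δ w → ∀ {m n r} (i : Fin m) .(p : suc r ≡ m + n)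
                      (u : Cliff δ m) (v : Cliff δ n) →
                      pair (at w) (composeBasis i p u v) ≈ at w u ⋆ at [] v ⊹ at [] u ⋆ at w v
  prime-coefficient {w} prime i p u′@(mkCliff u _ s) v′@(mkCliff v _ t) =
    K.trans (pair-E-or-0 w isCliff (u □[ suc (toℕ i) ] v) (size-□ u (suc (toℕ i)) v s t p)) cases
    where
    open IsPrime prime

    [_≟w] : Word → Scalar
    [ t ≟w] = [ t ≟ w ]

    cases : [ u □[ suc (toℕ i) ] v ≟ w ] ≈ [ u ≟ w ] ⋆ [ v ≟ [] ] ⊹ [ u ≟ [] ] ⋆ [ v ≟ w ]
    cases with ≡-dec ℕₚ._≟_ v [] | ≡-dec ℕₚ._≟_ u []
    ... | yes refl | _ = begin
      [ u □[ suc (toℕ i) ] [] ≟ w ]    ≈⟨ K.reflexive (cong [_≟w] (□-ε u (suc (toℕ i)))) ⟩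
      [ u ≟ w ]                        ≈⟨ K.*-identityʳ _ ⟨
      [ u ≟ w ] ⋆ 1#                   ≈⟨ K.+-identityʳ _ ⟨
      [ u ≟ w ] ⋆ 1# ⊹ 0#              ≈⟨ +-congˡ (K.zeroʳ _) ⟨
      [ u ≟ w ] ⋆ 1# ⊹ _ ⋆ 0#          ≈⟨ +-congˡ (*-congˡ (≟-no (nonempty ∘ sym))) ⟨
      [ u ≟ w ] ⋆ 1# ⊹ _ ⋆ [ [] ≟ w ]  ∎
    ... | no _ | yes refl = begin
      [ [] □[ suc (toℕ i) ] v ≟ w ]    ≈⟨ K.reflexive (cong [_≟w] (ε-□ (suc (toℕ i)) v)) ⟩
      [ v ≟ w ]                        ≈⟨ K.*-identityˡ _ ⟨
      1# ⋆ [ v ≟ w ]                   ≈⟨ K.+-identityˡ _ ⟨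
      0# ⊹ 1# ⋆ [ v ≟ w ]              ≈⟨ +-congʳ (K.zeroʳ _) ⟨
      [ [] ≟ w ] ⋆ 0# ⊹ 1# ⋆ [ v ≟ w ] ∎
    ... | no v≢ε | no u≢ε = begin
      [ u □[ suc (toℕ i) ] v ≟ w ]     ≈⟨ ≟-no decomposition ⟩
      0#                               ≈⟨ K.+-identityʳ _ ⟨
      0# ⊹ 0#                          ≈⟨ +-cong (K.zeroʳ _) (K.zeroˡ _) ⟨
      [ u ≟ w ] ⋆ 0# ⊹ 0# ⋆ [ v ≟ w ]  ∎
      where
      decomposition : u □[ suc (toℕ i) ] v ≢ w
      decomposition e =
        [ v≢ε ∘ proj₂ , u≢ε ∘ proj₁ ]′
          (indecomposable u v (suc (toℕ i)) (relevant δ u′) (relevant δ v′)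
            (s≤s z≤n) (s≤s (position δ u′ i)) (sym e))

  private
    ⟦_⟧ : ∀ {n} → Term n → Element n
    ⟦_⟧ = Morphism.⟦_⟧ (canonicalMorphism unimodal)

  generatorAt : Word → ∀ {n} → Generator δ n → Scalar
  generatorAt w g = [ Generator.word g ≟ w ]

  -- Since it can be read off from the image in the cliff operad, this coefficient vanishes on
  -- relations. On composites the claim is `ε-coefficient` extended bilinearly.
  unitCoeff-⟦⟧ : ∀ {n} (x : Term n) → unitCoeff x ≈ pair (at []) ⟦ x ⟧
  unitCoeff-⟦⟧ (gen g@(mkGenerator w prime s)) = begin
    0#                         ≈⟨ ≟-no (λ e → ⊥-elim-irr (IsPrime.nonempty prime e)) ⟨
    [ w ≟ [] ]                 ≈⟨ pair-E (at []) (cliff g) ⟨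
    pair (at []) (E (cliff g)) ∎
  unitCoeff-⟦⟧ unit = K.sym (pair-E (at []) ε)
  unitCoeff-⟦⟧ (x ∘[ i ] y by p) = begin
    unitCoeff x ⋆ unitCoeff y
      ≈⟨ *-cong (unitCoeff-⟦⟧ x) (unitCoeff-⟦⟧ y) ⟩
    pair (at []) ⟦ x ⟧ ⋆ pair (at []) ⟦ y ⟧
      ≈⟨ pair-product (at []) (at []) ⟦ x ⟧ ⟦ y ⟧ ⟨
    pair (λ u → pair (λ v → at [] u ⋆ at [] v) ⟦ y ⟧) ⟦ x ⟧
      ≈⟨ pair-cong (λ u → pair-cong (ε-coefficient i p u) ⟦ y ⟧) ⟦ x ⟧ ⟨
    pair (λ u → pair (λ v → pair (at []) (composeBasis i p u v)) ⟦ y ⟧) ⟦ x ⟧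
      ≈⟨ pair-bilinear (composeBasis i p) (at []) ⟦ x ⟧ ⟦ y ⟧ ⟨
    pair (at []) (compose ⟦ x ⟧ i ⟦ y ⟧ p) ∎
  unitCoeff-⟦⟧ 𝟘 = K.refl
  unitCoeff-⟦⟧ (x ⊕ y) =
    K.trans (+-cong (unitCoeff-⟦⟧ x) (unitCoeff-⟦⟧ y)) (K.sym (pair-++ (at []) ⟦ x ⟧ ⟦ y ⟧))
  unitCoeff-⟦⟧ (k ⊛ x) =
    K.trans (*-congˡ (unitCoeff-⟦⟧ x)) (K.sym (pair-scale (at []) k ⟦ x ⟧))

  module _ {w} (prime : IsPrime δ w) where
    -- As for the unit coefficient, with `prime-coefficient` extended bilinearly. The quadratic
    -- coefficient does not factor through the cliff operad in this way, and therefore can be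
    -- nonzero on a relation.
    linearCoeff-⟦⟧ : ∀ {n} (x : Term n) → linearCoeff (generatorAt w) x ≈ pair (at w) ⟦ x ⟧
    linearCoeff-⟦⟧ (gen g) = K.sym (pair-E (at w) (cliff g))
    linearCoeff-⟦⟧ unit =
      K.sym (K.trans (pair-E (at w) ε) (≟-no (IsPrime.nonempty prime ∘ sym)))
    linearCoeff-⟦⟧ (x ∘[ i ] y by p) = begin
      linearCoeff (generatorAt w) x ⋆ unitCoeff y ⊹ unitCoeff x ⋆ linearCoeff (generatorAt w) y
        ≈⟨ +-cong (*-cong (linearCoeff-⟦⟧ x) (unitCoeff-⟦⟧ y))
                  (*-cong (unitCoeff-⟦⟧ x) (linearCoeff-⟦⟧ y)) ⟩
      pair (at w) ⟦ x ⟧ ⋆ pair (at []) ⟦ y ⟧ ⊹ pair (at []) ⟦ x ⟧ ⋆ pair (at w) ⟦ y ⟧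
        ≈⟨ +-cong (pair-product (at w) (at []) ⟦ x ⟧ ⟦ y ⟧)
                  (pair-product (at []) (at w) ⟦ x ⟧ ⟦ y ⟧) ⟨
      pair (λ u → pair (λ v → at w u ⋆ at [] v) ⟦ y ⟧) ⟦ x ⟧ ⊹
      pair (λ u → pair (λ v → at [] u ⋆ at w v) ⟦ y ⟧) ⟦ x ⟧
        ≈⟨ pair-+ _ _ ⟦ x ⟧ ⟨
      pair (λ u → pair (λ v → at w u ⋆ at [] v) ⟦ y ⟧ ⊹ pair (λ v → at [] u ⋆ at w v) ⟦ y ⟧) ⟦ x ⟧
        ≈⟨ pair-cong (λ u → pair-+ _ _ ⟦ y ⟧) ⟦ x ⟧ ⟨
      pair (λ u → pair (λ v → at w u ⋆ at [] v ⊹ at [] u ⋆ at w v) ⟦ y ⟧) ⟦ x ⟧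
        ≈⟨ pair-cong (λ u → pair-cong (prime-coefficient prime i p u) ⟦ y ⟧) ⟦ x ⟧ ⟨
      pair (λ u → pair (λ v → pair (at w) (composeBasis i p u v)) ⟦ y ⟧) ⟦ x ⟧
        ≈⟨ pair-bilinear (composeBasis i p) (at w) ⟦ x ⟧ ⟦ y ⟧ ⟨
      pair (at w) (compose ⟦ x ⟧ i ⟦ y ⟧ p) ∎
    linearCoeff-⟦⟧ 𝟘 = K.refl
    linearCoeff-⟦⟧ (x ⊕ y) =
      K.trans (+-cong (linearCoeff-⟦⟧ x) (linearCoeff-⟦⟧ y))
              (K.sym (pair-++ (at w) ⟦ x ⟧ ⟦ y ⟧))
    linearCoeff-⟦⟧ (k ⊛ x) =
      K.trans (*-congˡ (linearCoeff-⟦⟧ x)) (K.sym (pair-scale (at w) k ⟦ x ⟧))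

  relation⇒unitCoeff≈0 : ∀ {n} (x : Term n) → NontrivialRelations unimodal x → unitCoeff x ≈ 0#
  relation⇒unitCoeff≈0 x r = K.trans (unitCoeff-⟦⟧ x) (≃⇒pair≈ _≟ᶜ_ r (at []))

  relation⇒linearCoeff≈0 : ∀ {w} → IsPrime δ w → ∀ {n} (x : Term n) →
                           NontrivialRelations unimodal x → linearCoeff (generatorAt w) x ≈ 0#
  relation⇒linearCoeff≈0 {w} prime x r = K.trans (linearCoeff-⟦⟧ prime x) (≃⇒pair≈ _≟ᶜ_ r (at w))

  module _ {u z} (prime-u : IsPrime δ u) (prime-z : IsPrime δ z) {S : List (Σ ℕ Term)}
           (relations : ∀ {n} {x : Term n} → IdealGeneratedBy (free K (Generator δ)) S x →
                        NontrivialRelations unimodal x)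
    where
    private
      quadratic : ∀ {n} → Term n → Scalar
      quadratic = quadraticCoeff (generatorAt u) (generatorAt z)

    -- Induction on membership; elements of `S` have too small an arity. In a composite with a
    -- relation, the unit and linear coefficients of the relation vanish. This kills every summand
    -- except the product of its quadratic coefficient with the unit coefficient of the other
    -- factor.
    quadraticCoeff-ideal : ∀ {n} {x : Term n} → maxArity S < n →
                           IdealGeneratedBy (free K (Generator δ)) S x → quadratic x ≈ 0#
    quadraticCoeff-ideal S<n (generator x∈S) =
      contradiction (∈⇒≤maxArity x∈S) (ℕₚ.<⇒≱ S<n)
    quadraticCoeff-ideal S<n (resp-≈ x≋y I) =
      K.trans (K.sym (quadraticCoeff-cong _ _ x≋y)) (quadraticCoeff-ideal S<n I)
    quadraticCoeff-ideal S<n zero-mem = K.refl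
    quadraticCoeff-ideal S<n (+-mem I J) =
      K.trans (+-cong (quadraticCoeff-ideal S<n I) (quadraticCoeff-ideal S<n J)) (K.+-identityˡ _)
    quadraticCoeff-ideal S<n (*-mem k I) =
      K.trans (*-congˡ (quadraticCoeff-ideal S<n I)) (K.zeroʳ k)
    quadraticCoeff-ideal S<r (∘-memˡ {m} {n} {r} {x} i y p I) = begin
      quadratic x ⋆ unitCoeff y ⊹ unitCoeff x ⋆ quadratic y ⊹ linearCoeff _ x ⋆ linearCoeff _ y
        ≈⟨ +-cong (+-cong first (*-congʳ (relation⇒unitCoeff≈0 x (relations I))))
                  (*-congʳ (relation⇒linearCoeff≈0 prime-u x (relations I))) ⟩
      0# ⊹ 0# ⋆ quadratic y ⊹ 0# ⋆ linearCoeff _ y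
        ≈⟨ +-cong (+-congˡ (K.zeroˡ _)) (K.zeroˡ _) ⟩
      0# ⊹ 0# ⊹ 0#
        ≈⟨ K.trans (+-congʳ (K.+-identityˡ _)) (K.+-identityˡ _) ⟩
      0# ∎
      where
      -- If `y` has arity other than 1, its unit coefficient is zero. If it has arity 1, then `x`
      -- has the arity of the composite, which is still above the bound, and induction applies.
      first : quadratic x ⋆ unitCoeff y ≈ 0#
      first with n ℕₚ.≟ 1
      ... | no n≢1   = K.trans (*-congˡ (unitCoeff-arity n≢1 y)) (K.zeroʳ _)
      ... | yes refl = K.trans (*-congʳ (quadraticCoeff-ideal S<m I)) (K.zeroˡ _)
        where
        S<m : maxArity S < m
        S<m = subst (maxArity S <_)
          (ℕₚ.suc-injective (trans (recompute (_ ℕₚ.≟ _) p) (ℕₚ.+-comm m 1))) S<r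
    quadraticCoeff-ideal S<r (∘-memʳ {m} {n} {r} x i {y} p I) = begin
      quadratic x ⋆ unitCoeff y ⊹ unitCoeff x ⋆ quadratic y ⊹ linearCoeff _ x ⋆ linearCoeff _ y
        ≈⟨ +-cong (+-cong (*-congˡ (relation⇒unitCoeff≈0 y (relations I))) second)
                  (*-congˡ (relation⇒linearCoeff≈0 prime-z y (relations I))) ⟩
      quadratic x ⋆ 0# ⊹ 0# ⊹ linearCoeff _ x ⋆ 0#
        ≈⟨ +-cong (+-congʳ (K.zeroʳ _)) (K.zeroʳ _) ⟩
      0# ⊹ 0# ⊹ 0#
        ≈⟨ K.trans (+-congʳ (K.+-identityˡ _)) (K.+-identityˡ _) ⟩
      0# ∎
      where
      -- The same dichotomy, now on the arity of the outer factor.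
      second : unitCoeff x ⋆ quadratic y ≈ 0#
      second with m ℕₚ.≟ 1
      ... | no m≢1   = K.trans (*-congʳ (unitCoeff-arity m≢1 x)) (K.zeroˡ _)
      ... | yes refl = K.trans (*-congˡ (quadraticCoeff-ideal S<n I)) (K.zeroʳ _)
        where
        S<n : maxArity S < n
        S<n = subst (maxArity S <_) (ℕₚ.suc-injective (recompute (_ ℕₚ.≟ _) p)) S<r

-- Least witnesses, and counts of small letters.

least : {P : ℕ → Set} → Decidable P → ∀ {n} → P n → ∃[ m ] (P m × (∀ {j} → j < m → ¬ P j))
least P? {zero}  p = zero , p , λ ()
least P? {suc n} p with P? 0
... | yes p₀ = zero , p₀ , λ ()
... | no ¬p₀ with m , pₘ , below ← least (P? ∘ suc) p =
  suc m , pₘ , λ { {zero} _ → ¬p₀ ; {suc j} (s≤s j<m) → below j<m }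

module LetterCount (c : ℕ) where
  small : Word → ℕ
  small w = length (filter (ℕₚ._≤? c) w)

  HasLarge : Word → Set
  HasLarge = Any (c <_)

  small-++ : ∀ u v → small (u ++ v) ≡ small u + small v
  small-++ u v = trans (cong length (filter-++ (ℕₚ._≤? c) u v)) (length-++ (filter (ℕₚ._≤? c) u))

  small-□ : ∀ u i v → small (u □[ i ] v) ≡ small u + small v
  small-□ u i v = begin
    small (a ++ v ++ b)            ≡⟨ small-++ a (v ++ b) ⟩
    small a + small (v ++ b)       ≡⟨ cong (small a +_) (small-++ v b) ⟩
    small a + (small v + small b)  ≡⟨ cong (small a +_) (ℕₚ.+-comm (small v) _) ⟩
    small a + (small b + small v)  ≡⟨ ℕₚ.+-assoc (small a) _ _ ⟨
    small a + small b + small v    ≡⟨ cong (_+ small v) (small-++ a b) ⟨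
    small (a ++ b) + small v       ≡⟨ cong (λ w → small w + small v) (take++drop≡id (i ∸ 1) u) ⟩
    small u + small v              ∎
    where
    open ≡-Reasoning
    a = take (i ∸ 1) u
    b = drop (i ∸ 1) u

  large-□ : ∀ u i v → HasLarge (u □[ i ] v) → HasLarge u ⊎ HasLarge v
  large-□ u i v l with Any.++⁻ (take (i ∸ 1) u) l
  ... | inj₁ l′ = inj₁ (subst HasLarge (take++drop≡id (i ∸ 1) u) (Any.++⁺ˡ l′))
  ... | inj₂ l′ with Any.++⁻ v l′
  ...   | inj₁ l″ = inj₂ l″
  ...   | inj₂ l″ =
    inj₁ (subst HasLarge (take++drop≡id (i ∸ 1) u) (Any.++⁺ʳ (take (i ∸ 1) u) l″))

  small≡0⇒[] : ∀ w → small w ≡ 0 → ¬ HasLarge w → w ≡ []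
  small≡0⇒[] []      _ _ = refl
  small≡0⇒[] (x ∷ w) e ¬l with x ℕₚ.≤? c
  ... | yes x≤c = contradiction
    (trans (sym (cong length (filter-accept (ℕₚ._≤? c) x≤c))) e) λ ()
  ... | no x≰c  = contradiction (here (ℕₚ.≰⇒> x≰c)) ¬l

  -- The first `a` letters are small as far as they exist, so a large letter sits beyond them and
  -- forces all `a` of them to exist.
  prefix≤small : ∀ a w → (∀ i → toℕ i < a → lookup w i ≤ c) → HasLarge w → a ≤ small w
  prefix≤small zero    w       f l         = z≤n
  prefix≤small (suc a) (x ∷ w) f (here c<x) = contradiction (f zero (s≤s z≤n)) (ℕₚ.<⇒≱ c<x)
  prefix≤small (suc a) (x ∷ w) f (there l) =
    subst (suc a ≤_) (sym (cong length (filter-accept (ℕₚ._≤? c) (f zero (s≤s z≤n)))))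
      (s≤s (prefix≤small a w (λ i i<a → f (suc i) (s≤s i<a)) l))

-- Prime cliffs of unbounded length.

single-isPrime : ∀ δ → IsPrime δ (0 ∷ [])
single-isPrime δ = record
  { nonempty       = λ ()
  ; isCliff        = λ { zero → z≤n }
  ; indecomposable = λ u v i _ _ _ _ e → cases u v i e
  }
  where
  cases : ∀ u v i → 0 ∷ [] ≡ u □[ i ] v → (u ≡ 0 ∷ [] × v ≡ []) ⊎ (u ≡ [] × v ≡ 0 ∷ [])
  cases u []              i e = inj₁ (sym (trans e (□-ε u i)) , refl)
  cases []      v@(_ ∷ _) i e = inj₂ (refl , sym (trans e (ε-□ i v)))
  cases (x ∷ u) (y ∷ v)   i e =
    contradiction (trans (cong length e) (trans (length-□ (x ∷ u) i (y ∷ v))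
      (cong suc (ℕₚ.+-suc (length u) (length v))))) λ ()

module LongPrimes (δ : RangeMap) (a : ℕ)
                  (below : ∀ j → j < suc a → δ (suc j) ≤ δ 1)
                  (above : ∀ j → suc a ≤ j → δ 1 < δ (suc j))
                  (k : ℕ) where
  open LetterCount (δ 1)

  -- The letter is the least one above δ(1), so `above` admits it at every position from a + 2 on.
  -- The number of copies is free apart from being positive, which guarantees a large letter.
  tail : Word
  tail = replicate (suc k) (suc (δ 1))

  longWord : Word
  longWord = replicate (suc a) 0 ++ tail

  private
    lookup-replicate : ∀ n {x : ℕ} i → lookup (replicate n x) i ≡ x
    lookup-replicate (suc n) zero    = refl
    lookup-replicate (suc n) (suc i) = lookup-replicate n i

    lookup-zeros : ∀ b w i → lookup (replicate b 0 ++ w) i ≡ 0 ⊎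
                             (b ≤ toℕ i × ∃[ j ] lookup (replicate b 0 ++ w) i ≡ lookup w j)
    lookup-zeros zero    w i       = inj₂ (z≤n , i , refl)
    lookup-zeros (suc b) w zero    = inj₁ refl
    lookup-zeros (suc b) w (suc i) with lookup-zeros b w i
    ... | inj₁ e             = inj₁ e
    ... | inj₂ (b≤i , j , e) = inj₂ (s≤s b≤i , j , e)

  longWord-isCliff : IsCliff δ longWord
  longWord-isCliff i with lookup-zeros (suc a) tail i
  ... | inj₁ e             = subst (_≤ δ (suc (toℕ i))) (sym e) z≤n
  ... | inj₂ (a<i , j , e) =
    subst (_≤ δ (suc (toℕ i))) (sym (trans e (lookup-replicate (suc k) j))) (above _ a<i)

  small-longWord : small longWord ≡ suc a
  small-longWord = begin
    small longWord
      ≡⟨ small-++ (replicate (suc a) 0) tail ⟩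
    small (replicate (suc a) 0) + small tail
      ≡⟨ cong₂ _+_ (cong length (filter-all (ℕₚ._≤? δ 1) (All.replicate⁺ (suc a) z≤n)))
                   (cong length (filter-none (ℕₚ._≤? δ 1) (All.replicate⁺ (suc k) ℕₚ.1+n≰n))) ⟩
    length (replicate (suc a) 0) + 0
      ≡⟨ trans (ℕₚ.+-identityʳ _) (length-replicate (suc a)) ⟩
    suc a ∎
    where open ≡-Reasoning

  -- By `below`, the first a + 1 positions of any cliff admit small letters only.
  cliff⇒a<small : ∀ {w} → IsCliff δ w → HasLarge w → suc a ≤ small w
  cliff⇒a<small {w} w-cliff =
    prefix≤small (suc a) w λ i i<a → ℕₚ.≤-trans (w-cliff i) (below _ i<a)

  -- A cliff with a letter above δ(1) has all a + 1 small letters of the word, so of two factors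
  -- only one has large letters and the other one has no letters at all.
  longWord-isPrime : IsPrime δ longWord
  longWord-isPrime = record
    { nonempty       = λ ()
    ; isCliff        = longWord-isCliff
    ; indecomposable = λ u v i cliff-u cliff-v _ _ e →
        cases u v i cliff-u cliff-v e (any? (δ 1 ℕₚ.<?_) u) (any? (δ 1 ℕₚ.<?_) v)
    }
    where
    cases : ∀ u v i → IsCliff δ u → IsCliff δ v → longWord ≡ u □[ i ] v →
            Dec (HasLarge u) → Dec (HasLarge v) →
            (u ≡ longWord × v ≡ []) ⊎ (u ≡ [] × v ≡ longWord)
    cases u v i cliff-u cliff-v e = go
      where
      total : small u + small v ≡ suc a
      total = trans (sym (small-□ u i v)) (trans (cong small (sym e)) small-longWord)

      go : Dec (HasLarge u) → Dec (HasLarge v) → (u ≡ longWord × v ≡ []) ⊎ (u ≡ [] × v ≡ longWord)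
      go (yes lu) (yes lv) = contradiction
        (subst (suc a + suc a ≤_) total
          (ℕₚ.+-mono-≤ (cliff⇒a<small cliff-u lu) (cliff⇒a<small cliff-v lv)))
        (ℕₚ.m+1+n≰m (suc a))
      go (yes lu) (no ¬lv) with refl ← small≡0⇒[] v
        (ℕₚ.n≤0⇒n≡0 (ℕₚ.+-cancelˡ-≤ (suc a) _ _
          (ℕₚ.≤-trans (ℕₚ.+-monoˡ-≤ _ (cliff⇒a<small cliff-u lu))
            (ℕₚ.≤-reflexive (trans total (sym (ℕₚ.+-identityʳ _))))))) ¬lv
        = inj₁ (sym (trans e (□-ε u i)) , refl)
      go (no ¬lu) (yes lv) with refl ← small≡0⇒[] u
        (ℕₚ.n≤0⇒n≡0 (ℕₚ.+-cancelʳ-≤ (suc a) _ _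
          (ℕₚ.≤-trans (ℕₚ.+-monoʳ-≤ (small u) (cliff⇒a<small cliff-v lv))
            (ℕₚ.≤-reflexive total)))) ¬lu
        = inj₂ (refl , sym (trans e (ε-□ i v)))
      go (no ¬lu) (no ¬lv) =
        [ (λ l → contradiction l ¬lu) , (λ l → contradiction l ¬lv) ]′
          (large-□ u i v (subst HasLarge e (Any.++⁺ʳ (replicate (suc a) 0) (here (ℕₚ.n<1+n _)))))

-- The position from which δ exceeds δ(1).

module Threshold (δ : RangeMap) (unimodal : Unimodal δ) (¬dominated : ¬ OneDominated δ) where
  Large : ℕ → Set
  Large j = δ 1 < δ (suc j)

  -- Otherwise δ would be 1-dominated from position n + 1 on. Refuting domination exhibits no
  -- position constructively, hence the double negation.
  large-beyond : ∀ n → ¬ ¬ (∃[ j ] (n ≤ j × Large j))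
  large-beyond n none = ¬dominated (suc n , s≤s z≤n , λ
    { (suc j) (s≤s n≤j) → ℕₚ.≮⇒≥ λ large → none (j , n≤j , large) })

  -- A later value at most δ(1) would be a valley between the large value at `i` and some large
  -- value further on, against unimodality. As `Large` is decidable, the conclusion holds without
  -- double negation.
  large-upward : ∀ {i} → Large i → ∀ j → i ≤ j → Large j
  large-upward {i} large-i j i≤j with δ 1 ℕₚ.<? δ (suc j) | i ℕₚ.≟ j
  ... | yes large-j | _        = large-j
  ... | no ¬large-j | yes refl = contradiction large-i ¬large-j
  ... | no ¬large-j | no i≢j   = contradiction
    (λ { (k , j<k , large-k) → unimodal (suc i) (suc j) (suc k)
           (s≤s (ℕₚ.≤∧≢⇒< i≤j i≢j)) (s≤s j<k)
           (ℕₚ.≤-<-trans (ℕₚ.≮⇒≥ ¬large-j) large-i , ℕₚ.≤-<-trans (ℕₚ.≮⇒≥ ¬large-j) large-k) })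
    (large-beyond (suc j))

  ¬¬threshold : ¬ ¬ (∃[ a ] ((∀ j → j < suc a → δ (suc j) ≤ δ 1) ×
                             (∀ j → suc a ≤ j → δ 1 < δ (suc j))))
  ¬¬threshold none = large-beyond 0 λ { (_ , _ , large) →
    none (from-least (least (λ j → δ 1 ℕₚ.<? δ (suc j)) large)) }
    where
    from-least : ∃[ m ] (Large m × (∀ {j} → j < m → ¬ Large j)) →
                 ∃[ a ] ((∀ j → j < suc a → δ (suc j) ≤ δ 1) ×
                         (∀ j → suc a ≤ j → δ 1 < δ (suc j)))
    -- Index 0 is position 1, where δ cannot exceed δ(1); so the least large index is a successor,
    -- and its predecessor is the required `a`.
    from-least (zero  , large , _)     = contradiction large (ℕₚ.<-irrefl refl)
    from-least (suc a , large , below) =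
      a , (λ _ j<a → ℕₚ.≮⇒≥ (below j<a)) , large-upward large

-- The quadratic relation between a prime and the letter 0.

module LetterRelation {c ℓ} (K : CommutativeRing c ℓ) (δ : RangeMap) (unimodal : Unimodal δ)
                      {u : Word} (prime : IsPrime δ u) where
  open CommutativeRing K using (_≈_; 0#; 1#; -_; setoid)
  private module K = CommutativeRing K
  open FreeOperad K (Generator δ) using (Term; gen; _∘[_]_by_; _⊕_; _⊛_)
  open FreeModule K using (pair; pair-bilinear; pair-++; pair-scale; pair≈⇒≃)
  open CliffOperad K δ
  open Coefficients K
  open CliffCoefficients K δ unimodal

  private
    ⟦_⟧ : ∀ {n} → Term n → Element n
    ⟦_⟧ = Morphism.⟦_⟧ (canonicalMorphism unimodal)

    L : ℕ
    L = length u

    L+2≡2+L : suc (2 + L) ≡ suc L + 2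
    L+2≡2+L = cong suc (ℕₚ.+-comm 2 L)

  primeGenerator : Generator δ (suc L)
  primeGenerator = mkGenerator u prime refl

  letter : Generator δ 2
  letter = mkGenerator (0 ∷ []) (single-isPrime δ) refl

  -- Both composites spell `u` followed by 0: one inserts `u` at the first input of the letter, the
  -- other inserts the letter at the last input of `u`, which is `fromℕ L` when counted from 0.
  letter∘prime prime∘letter : Term (2 + L)
  letter∘prime = gen letter ∘[ zero ] gen primeGenerator by refl
  prime∘letter = gen primeGenerator ∘[ fromℕ L ] gen letter by L+2≡2+L

  letterRelation : Term (2 + L)
  letterRelation = prime∘letter ⊕ (- 1#) ⊛ letter∘prime

  pair-compose-E : ∀ {m n r} (F : Cliff δ r → K.Carrier) (x : Cliff δ m) i (y : Cliff δ n)
                   .(p : suc r ≡ m + n) →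
                   pair F (compose (E x) i (E y) p) ≈ pair F (composeBasis i p x y)
  pair-compose-E F x i y p = begin
    pair F (compose (E x) i (E y) p)
      ≈⟨ pair-bilinear (composeBasis i p) F (E x) (E y) ⟩
    pair (λ a → pair (λ b → pair F (composeBasis i p a b)) (E y)) (E x)
      ≈⟨ pair-E (λ a → pair (λ b → pair F (composeBasis i p a b)) (E y)) x ⟩
    pair (λ b → pair F (composeBasis i p x b)) (E y)
      ≈⟨ pair-E (λ b → pair F (composeBasis i p x b)) y ⟩
    pair F (composeBasis i p x y) ∎
    where open SetoidReasoning setoid

  -- Both images are `E-or-0` of one and the same word, so they agree without deciding whether that
  -- word is a cliff.
  letterRelation-holds : NontrivialRelations unimodal letterRelation
  letterRelation-holds = pair≈⇒≃ _≟ᶜ_ λ F → begin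
    pair F (⟦ prime∘letter ⟧ ++ FreeModule.scale K (- 1#) ⟦ letter∘prime ⟧)
      ≈⟨ pair-++ F ⟦ prime∘letter ⟧ _ ⟩
    pair F ⟦ prime∘letter ⟧ K.+ pair F (FreeModule.scale K (- 1#) ⟦ letter∘prime ⟧)
      ≈⟨ K.+-cong (equal F) (pair-scale F (- 1#) ⟦ letter∘prime ⟧) ⟩
    pair F ⟦ letter∘prime ⟧ K.+ (- 1#) K.* pair F ⟦ letter∘prime ⟧
      ≈⟨ K.+-congˡ (RingProperties.-1*x≈-x K.ring _) ⟩
    pair F ⟦ letter∘prime ⟧ K.+ - pair F ⟦ letter∘prime ⟧
      ≈⟨ K.-‿inverseʳ _ ⟩
    0# ∎
    where
    open SetoidReasoning setoid

    words : u □[ suc (toℕ (fromℕ L)) ] (0 ∷ []) ≡ (0 ∷ []) □[ 1 ] u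
    words = cong₂ (λ s t → s ++ 0 ∷ t)
      (take-all _ u (ℕₚ.≤-reflexive (sym (toℕ-fromℕ L))))
      (drop-all _ u (ℕₚ.≤-reflexive (sym (toℕ-fromℕ L))))

    E-or-0-cong : ∀ {n} (F : Cliff δ n → K.Carrier) {v w} .(s : ∣ v ∣ ≡ n) .(t : ∣ w ∣ ≡ n) →
                  v ≡ w → pair F (E-or-0 v s) ≈ pair F (E-or-0 w t)
    E-or-0-cong F s t refl = K.refl

    equal : ∀ F → pair F ⟦ prime∘letter ⟧ ≈ pair F ⟦ letter∘prime ⟧
    equal F = begin
      pair F ⟦ prime∘letter ⟧
        ≈⟨ pair-compose-E F (cliff primeGenerator) (fromℕ L) (cliff letter) L+2≡2+L ⟩
      pair F (composeBasis (fromℕ L) L+2≡2+L (cliff primeGenerator) (cliff letter))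
        ≈⟨ E-or-0-cong F (size-□ u (suc (toℕ (fromℕ L))) (0 ∷ []) refl refl L+2≡2+L)
             (size-□ (0 ∷ []) 1 u refl refl refl) words ⟩
      pair F (composeBasis zero refl (cliff letter) (cliff primeGenerator))
        ≈⟨ pair-compose-E F (cliff letter) zero (cliff primeGenerator) refl ⟨
      pair F ⟦ letter∘prime ⟧ ∎

  -- `prime∘letter` contributes 1. The outer generator of `letter∘prime` is the letter 0, which the
  -- form at `u` does not see; for `u` equal to 0 the two contributions would cancel.
  quadraticCoeff-letterRelation : u ≢ 0 ∷ [] →
    quadraticCoeff (generatorAt u) (generatorAt (0 ∷ [])) letterRelation ≈ 1#
  quadraticCoeff-letterRelation u≢0 = begin
    0# K.* 0# K.+ 0# K.* 0# K.+ [ u ≟ u ] K.* 1# K.+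
      (- 1#) K.* (0# K.* 0# K.+ 0# K.* 0# K.+ [ 0 ∷ [] ≟ u ] K.* [ u ≟ 0 ∷ [] ])
      ≈⟨ K.+-cong (K.+-congˡ (K.*-congʳ (≟-yes {u} refl)))
           (K.*-congˡ (K.+-congˡ (K.*-congʳ (≟-no {w = u} (u≢0 ∘ sym))))) ⟩
    0# K.* 0# K.+ 0# K.* 0# K.+ 1# K.* 1# K.+
      (- 1#) K.* (0# K.* 0# K.+ 0# K.* 0# K.+ 0# K.* [ u ≟ 0 ∷ [] ])
      -- The scalar -1 can be treated as a variable, since its factor is zero.
      ≈⟨ solve 2 (λ m x → con 0 :* con 0 :+ con 0 :* con 0 :+ con 1 :* con 1 :+
           m :* (con 0 :* con 0 :+ con 0 :* con 0 :+ con 0 :* x) := con 1)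
           K.refl (- 1#) [ u ≟ 0 ∷ [] ] ⟩
    1# ∎
    where
    open SetoidReasoning setoid
    open NatSolver K.commutativeSemiring using (solve; con; _:+_; _:*_; _:=_)

-- Failure of finite generation.

proposition2p3p4 : ∀ {c ℓ₁ ℓ₂} (K : HeytingField c ℓ₁ ℓ₂) → CharacteristicZero K →
    (δ : RangeMap) (unimodal : Unimodal δ) → ¬ OneDominated δ →
    ¬ FinitelyGeneratedIdeal (free (baseRing K) (Generator δ))
    (CliffOperad.NontrivialRelations (baseRing K) δ unimodal)
proposition2p3p4 K char0 δ unimodal ¬dominated (S , generates) =
  -- The goal is empty, so a doubly negated threshold suffices.
  ¬¬threshold λ { (a , below , above) → absurd a below above }
  where
  open Threshold δ unimodal ¬dominated
  module F = CommutativeRing (baseRing K)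

  absurd : ∀ a → (∀ j → j < suc a → δ (suc j) ≤ δ 1) → (∀ j → suc a ≤ j → δ 1 < δ (suc j)) → ⊥
  absurd a below above =
    -- At 0, `char0` says that `1# + 0#` is not zero.
    char0 0 (F.trans (F.+-identityʳ F.1#) (F.trans (F.sym one) zero-coefficient))
    where
    -- With this many further large letters, the relation for `longWord` has arity above that of
    -- every element of `S`.
    k = maxArity S
    open LongPrimes δ a below above k
    open LetterRelation (baseRing K) δ unimodal longWord-isPrime
    open CliffCoefficients (baseRing K) δ unimodal
    open Coefficients (baseRing K) using (quadraticCoeff)

    quadratic : ∀ {n} → FreeOperad.Term (baseRing K) (Generator δ) n → F.Carrier
    quadratic = quadraticCoeff (generatorAt longWord) (generatorAt (0 ∷ []))

    tail≤ : length tail ≤ length (replicate a 0 ++ tail)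
    tail≤ = length-++-≤ʳ tail {replicate a 0}

    longWord≢0 : longWord ≢ 0 ∷ []
    longWord≢0 e = ℕₚ.n≮0 (ℕₚ.≤-trans tail≤ (ℕₚ.≤-reflexive (ℕₚ.suc-injective (cong length e))))

    one : quadratic letterRelation F.≈ F.1#
    one = quadraticCoeff-letterRelation longWord≢0

    long : k < 2 + length longWord
    long = s≤s (ℕₚ.m≤n⇒m≤1+n (ℕₚ.m≤n⇒m≤1+n (ℕₚ.≤-trans
      (ℕₚ.≤-reflexive (sym (length-replicate k))) (ℕₚ.≤-trans (ℕₚ.n≤1+n _) tail≤))))

    zero-coefficient : quadratic letterRelation F.≈ F.0#
    -- The equivalence is used both ways: the ideal consists of relations, and it contains
    -- `letterRelation`.
    zero-coefficient = quadraticCoeff-ideal longWord-isPrime (single-isPrime δ)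
      (λ {n} {x} I → Equivalence.from (generates x) I) long
      (Equivalence.to (generates letterRelation) letterRelation-holds)
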